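{- For every $n\geq 1$, $T_n(x,y)=T_{2,n}(x,y)+3T_{1,n}(x,y)+T_{0,n}(x,y)$, where $T_{2,n},T_{1,n},T_{0,n}\in\mathbb{Z}[x,y]$ satisfy the initial conditions $T_{2,1}=y+2$, $T_{1,1}=x-1$, $T_{0,1}=(x-1)^2$ and, for all $n\geq1$, the following identities (in $\mathbb{Q}(x,y)$), where $T_{i}$ abbreviates $T_{i,n}(x,y)$: $$T_{2,n+1}=(y-1)T_{2}^3+\frac{1}{x-1}\left(6T_{2}^2T_{1}+3T_{2}T_{1}^2\right),$$ $$T_{1,n+1}=(y-1)T_{2}^2T_{1}+\frac{1}{x-1}\left(T_{2}^2T_{0}+7T_{2}T_{1}^2+2T_{2}T_{1}T_{0}+4T_{1}^3+T_{1}^2T_{0}\right),$$ $$T_{0,n+1}=(y-1)\left(3T_{2}T_{1}^2+T_{1}^3\right)+\frac{1}{x-1}\left(12T_{2}T_{1}T_{0}+3T_{2}T_{0}^2+14T_{1}^3+24T_{1}^2T_{0}+9T_{1}T_{0}^2+T_{0}^3\right).$$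
   Context: Graphs are finite; multiple edges are allowed. For a graph $G$, a spanning subgraph $A$ has vertex set $V(G)$ and edge set $E(A)\subseteq E(G)$; $k(A)$ is its number of connected components, $r(A)=|V(G)|-k(A)$, $n(A)=|E(A)|-r(A)$. The Tutte polynomial is $T(G;x,y)=\sum_{A}(x-1)^{r(G)-r(A)}(y-1)^{n(A)}$, the sum over all spanning subgraphs $A$; call the summand the weight of $A$. Sierpiński graphs $\Gamma_n$ ($n\ge1$), each with three distinguished outmost vertices called top, left, right: $\Gamma_1$ is the triangle $K_3$ with its three vertices as top, left, right. $\Gamma_{n+1}$ is obtained from three disjoint copies $G_1,G_2,G_3$ of $\Gamma_n$ by identifying left$(G_1)$ with top$(G_2)$, right$(G_1)$ with top$(G_3)$, and right$(G_2)$ with left$(G_3)$; its outmost vertices are top$(G_1)$ (top), left$(G_2)$ (left), right$(G_3)$ (right). Then $|V(\Gamma_n)|=(3^n+3)/2$, $|E(\Gamma_n)|=3^n$. Write $T_n(x,y)=T(\Gamma_n;x,y)$. Define $T_{2,n}(x,y)$ as the sum of the weights (with respect to $G=\Gamma_n$) of the spanning subgraphs of $\Gamma_n$ in which the three outmost vertices lie in one component; $T_{1,n}(x,y)$ as the sum over spanning subgraphs in which the left and right outmost vertices lie in the same component and the top one lies in a different component; $T_{0,n}(x,y)$ as the sum over spanning subgraphs in which the three outmost vertices lie in three distinct components. -}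

module Defs where

open import Algebra.Bundles using (CommutativeRing; CommutativeSemigroup; Semiring)
import Algebra.Definitions.RawSemiring as RawSemiringDefinitions
import Algebra.Properties.CommutativeSemigroup as CommutativeSemigroupProperties
import Algebra.Properties.Group as GroupProperties
import Algebra.Properties.Ring as RingProperties
import Algebra.Solver.Ring.NaturalCoefficients.Default as SemiringSolver
open import Data.Empty using (⊥-elim)
open import Data.Fin.Base using (Fin; zero; suc; combine; punchIn; punchOut)
open import Data.Fin.Properties
  using (punchOut-cong; punchOut-injective; punchOut-punchIn; punchInᵢ≢i) renaming (_≟_ to _≟ᶠ_)
open import Data.Fin.Subset using (Subset; inside; outside; ⊤; ∣_∣; _∈_)
import Data.Integer.Base as ℤ
import Data.Integer.Properties as ℤₚ
open import Data.List.Base as List using (List; []; _∷_)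
open import Data.Nat.Base using (ℕ; zero; suc; _∸_; NonZero) renaming (_*_ to _*ℕ_)
open import Data.Product.Base using (∃; _×_; _,_; map)
open import Data.Sum.Base using (_⊎_; inj₁; inj₂; [_,_]′; map₁; map₂)
open import Data.Vec.Base as Vec using (Vec; []; _∷_; lookup; here; there)
open import Function.Base using (_∘_)
open import Function.Bundles using (_⇔_; mk⇔; Equivalence)
open import Function.Definitions using (Surjective)
open import Level using (Level; 0ℓ; _⊔_) renaming (suc to lsuc)
open import Relation.Binary.Core using (Rel)
open import Relation.Binary.Construct.Closure.Equivalence as EqClosure using (EqClosure)
open import Relation.Binary.Bundles using (Setoid)
open import Relation.Binary.Structures using (IsEquivalence)
open import Relation.Binary.PropositionalEquality as ≡ using (_≡_; _≢_; refl; cong)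
import Relation.Binary.Reasoning.Setoid as SetoidReasoning
open import Relation.Nullary using (¬_; Dec; yes; no; ¬?; _×-dec_)
open import Relation.Nullary.Decidable using () renaming (map to map-dec)
open import Relation.Unary using (Pred; Decidable)

private
  variable
    c ℓ : Level
    n m : ℕ

record IntegralDomain c ℓ : Set (lsuc (c ⊔ ℓ)) where
  field
    commutativeRing : CommutativeRing c ℓ
  open CommutativeRing commutativeRing public
  field
    1≉0         : 1# ≉ 0#
    zeroProduct : ∀ x y → x * y ≈ 0# → x ≈ 0# ⊎ y ≈ 0#

  open RawSemiringDefinitions (Semiring.rawSemiring semiring) public using (_^_) renaming (_×_ to _·_)

  *-≉0 : ∀ {x y} → x ≉ 0# → y ≉ 0# → x * y ≉ 0#
  *-≉0 {x} {y} x≉0 y≉0 xy≈0 with zeroProduct x y xy≈0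
  ... | inj₁ x≈0 = x≉0 x≈0
  ... | inj₂ y≈0 = y≉0 y≈0

  *-cancelʳ : ∀ {x y z} → z ≉ 0# → x * z ≈ y * z → x ≈ y
  *-cancelʳ {x} {y} {z} z≉0 xz≈yz with zeroProduct (x - y) z
    (trans ([y-z]x≈yx-zx z x y) (trans (+-congʳ xz≈yz) (-‿inverseʳ (y * z))))
    where open RingProperties ring using ([y-z]x≈yx-zx)
  ... | inj₁ x-y≈0 = x∙y⁻¹≈ε⇒x≈y x y x-y≈0
    where open GroupProperties +-group using (x∙y⁻¹≈ε⇒x≈y)
  ... | inj₂ z≈0   = ⊥-elim (z≉0 z≈0)

-- Univariate polynomials over an integral domain: the list
-- a₀ ∷ a₁ ∷ … ∷ [] is a₀ + a₁X + …; trailing zeros are permitted, so two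
-- lists are equal as polynomials when all their coefficients agree.

module Polynomials (D : IntegralDomain c ℓ) where

  private
    module R = IntegralDomain D
    open R using (Carrier; 0#; 1#)

  Polynomial : Set c
  Polynomial = List Carrier

  coeff : Polynomial → ℕ → Carrier
  coeff []      _       = 0#
  coeff (a ∷ p) zero    = a
  coeff (a ∷ p) (suc i) = coeff p i

  infix 4 _≈_
  record _≈_ (p q : Polynomial) : Set ℓ where
    constructor coeffwise
    field at : ∀ i → coeff p i R.≈ coeff q i
  open _≈_ public

  infixl 6 _+_
  infixl 7 _*_ _•_

  _+_ : Polynomial → Polynomial → Polynomial
  []      + q       = q
  (a ∷ p) + []      = a ∷ p
  (a ∷ p) + (b ∷ q) = (a R.+ b) ∷ (p + q)

  _•_ : Carrier → Polynomial → Polynomial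
  a • p = List.map (a R.*_) p

  -_ : Polynomial → Polynomial
  - p = List.map (R.-_) p

  _*_ : Polynomial → Polynomial → Polynomial
  []      * q = []
  (a ∷ p) * q = a • q + (0# ∷ p * q)

  constant : Carrier → Polynomial
  constant a = a ∷ []

  X : Polynomial
  X = 0# ∷ 1# ∷ []

  coeff-+ : ∀ p q i → coeff (p + q) i R.≈ coeff p i R.+ coeff q i
  coeff-+ []      q       i       = R.sym (R.+-identityˡ _)
  coeff-+ (a ∷ p) []      i       = R.sym (R.+-identityʳ _)
  coeff-+ (a ∷ p) (b ∷ q) zero    = R.refl
  coeff-+ (a ∷ p) (b ∷ q) (suc i) = coeff-+ p q i

  coeff-• : ∀ a p i → coeff (a • p) i R.≈ a R.* coeff p i
  coeff-• a []      i       = R.sym (R.zeroʳ a)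
  coeff-• a (b ∷ p) zero    = R.refl
  coeff-• a (b ∷ p) (suc i) = coeff-• a p i

  coeff-neg : ∀ p i → coeff (- p) i R.≈ R.- coeff p i
  coeff-neg []      i       = R.sym -0#≈0#
    where open RingProperties R.ring using (-0#≈0#)
  coeff-neg (b ∷ p) zero    = R.refl
  coeff-neg (b ∷ p) (suc i) = coeff-neg p i

  private
    ≈-refl : ∀ {p} → p ≈ p
    ≈-refl .at i = R.refl

    ≈-sym : ∀ {p q} → p ≈ q → q ≈ p
    ≈-sym p≈q .at i = R.sym (p≈q .at i)

    ≈-trans : ∀ {p q r} → p ≈ q → q ≈ r → p ≈ r
    ≈-trans p≈q q≈r .at i = R.trans (p≈q .at i) (q≈r .at i)

  ∷-cong : ∀ {a b p q} → a R.≈ b → p ≈ q → (a ∷ p) ≈ (b ∷ q)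
  ∷-cong a≈b p≈q .at zero    = a≈b
  ∷-cong a≈b p≈q .at (suc i) = p≈q .at i

  ∷-injectiveʳ : ∀ {a b p q} → (a ∷ p) ≈ (b ∷ q) → p ≈ q
  ∷-injectiveʳ e .at i = e .at (suc i)

  ∷-≈[] : ∀ {a p} → a R.≈ 0# → p ≈ [] → (a ∷ p) ≈ []
  ∷-≈[] a≈0 p≈[] .at zero    = a≈0
  ∷-≈[] a≈0 p≈[] .at (suc i) = p≈[] .at i

  ∷-≈[]⁻ : ∀ {a p} → (a ∷ p) ≈ [] → p ≈ []
  ∷-≈[]⁻ e .at i = e .at (suc i)

  private
    +-via : ∀ {p q r s} →
            (∀ i → coeff p i R.+ coeff q i R.≈ coeff r i R.+ coeff s i) → p + q ≈ r + s
    +-via {p} {q} {r} {s} e .at i =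
      R.trans (coeff-+ p q i) (R.trans (e i) (R.sym (coeff-+ r s i)))

    +-cong : ∀ {p q r s} → p ≈ q → r ≈ s → p + r ≈ q + s
    +-cong {p} {q} {r} {s} p≈q r≈s = +-via {p} {r} {q} {s} λ i → R.+-cong (p≈q .at i) (r≈s .at i)

    +-comm : ∀ p q → p + q ≈ q + p
    +-comm p q = +-via {p} {q} {q} {p} λ i → R.+-comm (coeff p i) (coeff q i)

    +-assoc : ∀ p q r → (p + q) + r ≈ p + (q + r)
    +-assoc p q r = +-via {p + q} {r} {p} {q + r} λ i →
      R.trans (R.+-congʳ (coeff-+ p q i))
        (R.trans (R.+-assoc _ _ _) (R.+-congˡ (R.sym (coeff-+ q r i))))

    +-identityʳ : ∀ p → p + [] ≈ p
    +-identityʳ p = +-comm p []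

    neg-cong : ∀ {p q} → p ≈ q → - p ≈ - q
    neg-cong {p} {q} p≈q .at i = R.trans (coeff-neg p i)
      (R.trans (R.-‿cong (p≈q .at i)) (R.sym (coeff-neg q i)))

    neg-inverseʳ : ∀ p → p + - p ≈ []
    neg-inverseʳ p .at i = R.trans (coeff-+ p (- p) i)
      (R.trans (R.+-congˡ (coeff-neg p i)) (R.-‿inverseʳ _))

    •-cong : ∀ {a b p q} → a R.≈ b → p ≈ q → a • p ≈ b • q
    •-cong {a} {b} {p} {q} a≈b p≈q .at i = R.trans (coeff-• a p i)
      (R.trans (R.*-cong a≈b (p≈q .at i)) (R.sym (coeff-• b q i)))

    •-zeroˡ : ∀ {a} p → a R.≈ 0# → a • p ≈ []
    •-zeroˡ {a} p a≈0 .at i =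
      R.trans (coeff-• a p i) (R.trans (R.*-congʳ a≈0) (R.zeroˡ _))

    •-identity : ∀ p → 1# • p ≈ p
    •-identity p .at i = R.trans (coeff-• 1# p i) (R.*-identityˡ _)

    •-distribˡ : ∀ a p q → a • (p + q) ≈ a • p + a • q
    •-distribˡ a p q .at i = R.trans (coeff-• a (p + q) i)
      (R.trans (R.*-congˡ (coeff-+ p q i)) (R.trans (R.distribˡ _ _ _)
        (R.trans (R.sym (R.+-cong (coeff-• a p i) (coeff-• a q i)))
          (R.sym (coeff-+ (a • p) (a • q) i)))))

    •-distribʳ : ∀ a b p → (a R.+ b) • p ≈ a • p + b • p
    •-distribʳ a b p .at i = R.trans (coeff-• (a R.+ b) p i)
      (R.trans (R.distribʳ _ _ _)
        (R.trans (R.sym (R.+-cong (coeff-• a p i) (coeff-• b p i)))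
          (R.sym (coeff-+ (a • p) (b • p) i))))

    •-assoc : ∀ a b p → (a R.* b) • p ≈ a • (b • p)
    •-assoc a b p .at i = R.trans (coeff-• (a R.* b) p i)
      (R.trans (R.*-assoc _ _ _)
        (R.trans (R.*-congˡ (R.sym (coeff-• b p i))) (R.sym (coeff-• a (b • p) i))))

    shift-+ : ∀ p q → (0# ∷ p + q) ≈ (0# ∷ p) + (0# ∷ q)
    shift-+ p q = ∷-cong (R.sym (R.+-identityˡ 0#)) ≈-refl

    ≈-isEquivalence : IsEquivalence _≈_
    ≈-isEquivalence = record { refl = ≈-refl ; sym = ≈-sym ; trans = ≈-trans }

    ≈-setoid : Setoid _ _
    ≈-setoid = record { isEquivalence = ≈-isEquivalence }

    +-commutativeSemigroup : CommutativeSemigroup _ _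
    +-commutativeSemigroup = record
      { isCommutativeSemigroup = record
        { isSemigroup = record
          { isMagma = record { isEquivalence = ≈-isEquivalence ; ∙-cong = +-cong }
          ; assoc   = +-assoc
          }
        ; comm = +-comm
        }
      }

    open SetoidReasoning ≈-setoid
    open CommutativeSemigroupProperties +-commutativeSemigroup
      using (interchange; x∙yz≈y∙xz)

    *-zeroˡ : ∀ {p} q → p ≈ [] → p * q ≈ []
    *-zeroˡ {[]}    q _ = ≈-refl
    *-zeroˡ {a ∷ p} q e = begin
      a • q + (0# ∷ p * q)  ≈⟨ +-cong (•-zeroˡ q (e .at 0))
                                 (∷-≈[] R.refl (*-zeroˡ q (∷-≈[]⁻ e))) ⟩
      []                    ∎

    *-zeroʳ : ∀ p → p * [] ≈ []
    *-zeroʳ []      = ≈-refl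
    *-zeroʳ (a ∷ p) = ∷-≈[] R.refl (*-zeroʳ p)

    *-cong : ∀ {p q r s} → p ≈ q → r ≈ s → p * r ≈ q * s
    *-cong {[]}    {q}     {s = s} e f = ≈-sym (*-zeroˡ s (≈-sym e))
    *-cong {a ∷ p} {[]}    {r = r} e f = *-zeroˡ r e
    *-cong {a ∷ p} {b ∷ q}         e f =
      +-cong (•-cong (e .at 0) f) (∷-cong R.refl (*-cong (∷-injectiveʳ e) f))

    *-distribʳ : ∀ r p q → (p + q) * r ≈ p * r + q * r
    *-distribʳ r []      q       = ≈-refl
    *-distribʳ r (a ∷ p) []      = ≈-sym (+-identityʳ _)
    *-distribʳ r (a ∷ p) (b ∷ q) = begin
      (a R.+ b) • r + (0# ∷ (p + q) * r)
        ≈⟨ +-cong (•-distribʳ a b r) (∷-cong R.refl (*-distribʳ r p q)) ⟩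
      (a • r + b • r) + (0# ∷ p * r + q * r)
        ≈⟨ +-cong ≈-refl (shift-+ (p * r) (q * r)) ⟩
      (a • r + b • r) + ((0# ∷ p * r) + (0# ∷ q * r))
        ≈⟨ interchange (a • r) (b • r) (0# ∷ p * r) (0# ∷ q * r) ⟩
      (a • r + (0# ∷ p * r)) + (b • r + (0# ∷ q * r)) ∎

    *-∷ : ∀ p b q → p * (b ∷ q) ≈ b • p + (0# ∷ p * q)
    *-∷ []      b q = ≈-sym (∷-≈[] R.refl ≈-refl)
    *-∷ (a ∷ p) b q = ∷-cong (R.+-congʳ (R.*-comm a b)) (begin
      a • q + p * (b ∷ q)
        ≈⟨ +-cong {a • q} ≈-refl (*-∷ p b q) ⟩
      a • q + (b • p + (0# ∷ p * q))
        ≈⟨ x∙yz≈y∙xz (a • q) (b • p) (0# ∷ p * q) ⟩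
      b • p + (a • q + (0# ∷ p * q)) ∎)

    *-comm : ∀ p q → p * q ≈ q * p
    *-comm []      q = ≈-sym (*-zeroʳ q)
    *-comm (a ∷ p) q = begin
      a • q + (0# ∷ p * q) ≈⟨ +-cong {a • q} ≈-refl (∷-cong R.refl (*-comm p q)) ⟩
      a • q + (0# ∷ q * p) ≈⟨ *-∷ q a p ⟨
      q * (a ∷ p)          ∎

    •-* : ∀ a p q → (a • p) * q ≈ a • (p * q)
    •-* a []      q = ≈-refl
    •-* a (b ∷ p) q = begin
      (a R.* b) • q + (0# ∷ (a • p) * q)
        ≈⟨ +-cong (•-assoc a b q) (∷-cong (R.sym (R.zeroʳ a)) (•-* a p q)) ⟩
      a • (b • q) + a • (0# ∷ p * q)
        ≈⟨ •-distribˡ a (b • q) (0# ∷ p * q) ⟨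
      a • (b • q + (0# ∷ p * q)) ∎

    shift-* : ∀ p q → (0# ∷ p) * q ≈ (0# ∷ p * q)
    shift-* p q = +-cong (•-zeroˡ q R.refl) ≈-refl

    *-assoc : ∀ p q r → (p * q) * r ≈ p * (q * r)
    *-assoc []      q r = ≈-refl
    *-assoc (a ∷ p) q r = begin
      (a • q + (0# ∷ p * q)) * r
        ≈⟨ *-distribʳ r (a • q) (0# ∷ p * q) ⟩
      (a • q) * r + (0# ∷ p * q) * r
        ≈⟨ +-cong (•-* a q r) (≈-trans (shift-* (p * q) r) (∷-cong R.refl (*-assoc p q r))) ⟩
      a • (q * r) + (0# ∷ p * (q * r)) ∎

    *-identityˡ : ∀ p → constant 1# * p ≈ p
    *-identityˡ p = begin
      1# • p + (0# ∷ []) ≈⟨ +-cong (•-identity p) (∷-≈[] R.refl ≈-refl) ⟩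
      p + []             ≈⟨ +-identityʳ p ⟩
      p                  ∎

  commutativeRing : CommutativeRing c ℓ
  commutativeRing = record
    { Carrier = Polynomial
    ; _≈_ = _≈_
    ; _+_ = _+_
    ; _*_ = _*_
    ; -_ = -_
    ; 0# = []
    ; 1# = constant 1#
    ; isCommutativeRing = record
      { isRing = record
        { +-isAbelianGroup = record
          { isGroup = record
            { isMonoid = record
              { isSemigroup = record
                { isMagma = record { isEquivalence = ≈-isEquivalence ; ∙-cong = +-cong }
                ; assoc = +-assoc
                }
              ; identity = (λ p → ≈-refl) , +-identityʳ
              }
            ; inverse = (λ p → ≈-trans (+-comm (- p) p) (neg-inverseʳ p)) , neg-inverseʳ
            ; ⁻¹-cong = neg-cong
            }
          ; comm = +-comm
          }
        ; *-cong = *-cong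
        ; *-assoc = *-assoc
        ; *-identity = *-identityˡ , λ p → ≈-trans (*-comm p (constant 1#)) (*-identityˡ p)
        ; distrib = (λ p q r → ≈-trans (*-comm p (q + r)) (≈-trans (*-distribʳ p q r)
                      (+-cong (*-comm q p) (*-comm r p))))
                  , *-distribʳ
        }
      ; *-comm = *-comm
      }
    }

  private
    zeroProduct : ∀ p q → p * q ≈ [] → p ≈ [] ⊎ q ≈ []
    zeroProduct []      q       _ = inj₁ ≈-refl
    zeroProduct (a ∷ p) []      _ = inj₂ ≈-refl
    zeroProduct ap@(a ∷ p) bq@(b ∷ q) e =
      [ (λ a≈0 → map₁ (∷-≈[] a≈0) (zeroProduct p bq (∷-≈[]⁻ (begin
          (0# ∷ p * bq)  ≈⟨ shift-* p bq ⟨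
          (0# ∷ p) * bq  ≈⟨ *-cong {0# ∷ p} {ap} {bq} (∷-cong (R.sym a≈0) ≈-refl) ≈-refl ⟩
          ap * bq        ≈⟨ e ⟩
          []             ∎))))
      , (λ b≈0 → map₂ (∷-≈[] b≈0) (zeroProduct ap q (∷-≈[]⁻ (begin
          (0# ∷ ap * q)          ≈⟨ +-cong (•-zeroˡ ap b≈0) ≈-refl ⟨
          b • ap + (0# ∷ ap * q) ≈⟨ *-∷ ap b q ⟨
          ap * bq                ≈⟨ e ⟩
          []                     ∎))))
      ]′ (R.zeroProduct a b (R.trans (R.sym (R.+-identityʳ (a R.* b))) (e .at 0)))

  integralDomain : IntegralDomain c ℓ
  integralDomain = record
    { commutativeRing = commutativeRing
    ; 1≉0             = λ e → R.1≉0 (e .at 0)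
    ; zeroProduct     = zeroProduct
    }

module Fractions (D : IntegralDomain c ℓ) where

  private
    module R = IntegralDomain D
    open R using (0#; 1#)
    open SemiringSolver R.commutativeSemiring using (solve; _:+_; _:*_; _:=_; con)

  infixl 7 _/_[_]
  record Fraction : Set (c ⊔ ℓ) where
    constructor _/_[_]
    field
      num   : R.Carrier
      den   : R.Carrier
      den≉0 : den R.≉ 0#
  open Fraction public

  infix 4 _≈_
  record _≈_ (p q : Fraction) : Set ℓ where
    constructor cross
    field uncross : num p R.* den q R.≈ num q R.* den p
  open _≈_ public

  embed : R.Carrier → Fraction
  embed a = a / 1# [ R.1≉0 ]

  infixl 6 _+_
  infixl 7 _*_

  _+_ : Fraction → Fraction → Fraction
  (a / b [ b≉0 ]) + (a′ / b′ [ b′≉0 ]) = (a R.* b′ R.+ a′ R.* b) / b R.* b′ [ R.*-≉0 b≉0 b′≉0 ]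

  _*_ : Fraction → Fraction → Fraction
  (a / b [ b≉0 ]) * (a′ / b′ [ b′≉0 ]) = (a R.* a′) / b R.* b′ [ R.*-≉0 b≉0 b′≉0 ]

  -_ : Fraction → Fraction
  - (a / b [ b≉0 ]) = (R.- a) / b [ b≉0 ]

  private
    open SetoidReasoning R.setoid
    open RingProperties R.ring using (-‿distribˡ-*)

    ≈-refl : ∀ {p} → p ≈ p
    ≈-refl = cross R.refl

    ≈-sym : ∀ {p q} → p ≈ q → q ≈ p
    ≈-sym (cross e) = cross (R.sym e)

    ≈-trans : ∀ {p q r} → p ≈ q → q ≈ r → p ≈ r
    ≈-trans {a / b [ _ ]} {a′ / b′ [ b′≉0 ]} {a″ / b″ [ _ ]} (cross e) (cross f) =
      cross (R.*-cancelʳ b′≉0 (begin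
        (a R.* b″) R.* b′  ≈⟨ solve 3 (λ a b″ b′ → (a :* b″) :* b′ := (a :* b′) :* b″) R.refl a b″ b′ ⟩
        (a R.* b′) R.* b″  ≈⟨ R.*-congʳ e ⟩
        (a′ R.* b) R.* b″  ≈⟨ solve 3 (λ a′ b b″ → (a′ :* b) :* b″ := (a′ :* b″) :* b) R.refl a′ b b″ ⟩
        (a′ R.* b″) R.* b  ≈⟨ R.*-congʳ f ⟩
        (a″ R.* b′) R.* b  ≈⟨ solve 3 (λ a″ b′ b → (a″ :* b′) :* b := (a″ :* b) :* b′) R.refl a″ b′ b ⟩
        (a″ R.* b) R.* b′  ∎))

    ≈-isEquivalence : IsEquivalence _≈_
    ≈-isEquivalence = record { refl = ≈-refl ; sym = ≈-sym ; trans = ≈-trans }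

    +-cong : ∀ {p q r s} → p ≈ q → r ≈ s → p + r ≈ q + s
    +-cong {a / b [ _ ]} {a′ / b′ [ _ ]} {u / v [ _ ]} {u′ / v′ [ _ ]} (cross e) (cross f) = cross (begin
      (a R.* v R.+ u R.* b) R.* (b′ R.* v′)
        ≈⟨ solve 6 (λ a v u b b′ v′ → (a :* v :+ u :* b) :* (b′ :* v′)
             := (a :* b′) :* (v :* v′) :+ (u :* v′) :* (b :* b′)) R.refl a v u b b′ v′ ⟩
      (a R.* b′) R.* (v R.* v′) R.+ (u R.* v′) R.* (b R.* b′)
        ≈⟨ R.+-cong (R.*-congʳ e) (R.*-congʳ f) ⟩
      (a′ R.* b) R.* (v R.* v′) R.+ (u′ R.* v) R.* (b R.* b′)
        ≈⟨ solve 6 (λ a′ b v v′ u′ b′ → (a′ :* b) :* (v :* v′) :+ (u′ :* v) :* (b :* b′)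
             := (a′ :* v′ :+ u′ :* b′) :* (b :* v)) R.refl a′ b v v′ u′ b′ ⟩
      (a′ R.* v′ R.+ u′ R.* b′) R.* (b R.* v) ∎)

    *-cong : ∀ {p q r s} → p ≈ q → r ≈ s → p * r ≈ q * s
    *-cong {a / b [ _ ]} {a′ / b′ [ _ ]} {u / v [ _ ]} {u′ / v′ [ _ ]} (cross e) (cross f) = cross (begin
      (a R.* u) R.* (b′ R.* v′)   ≈⟨ swap a u b′ v′ ⟩
      (a R.* b′) R.* (u R.* v′)   ≈⟨ R.*-cong e f ⟩
      (a′ R.* b) R.* (u′ R.* v)   ≈⟨ swap a′ b u′ v ⟩
      (a′ R.* u′) R.* (b R.* v)   ∎)
      where
      swap = solve 4 (λ a b c d → (a :* b) :* (c :* d) := (a :* c) :* (b :* d)) R.refl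

    neg-cong : ∀ {p q} → p ≈ q → - p ≈ - q
    neg-cong {a / b [ _ ]} {a′ / b′ [ _ ]} (cross e) = cross (begin
      R.- a R.* b′    ≈⟨ -‿distribˡ-* a b′ ⟨
      R.- (a R.* b′)  ≈⟨ R.-‿cong e ⟩
      R.- (a′ R.* b)  ≈⟨ -‿distribˡ-* a′ b ⟩
      R.- a′ R.* b    ∎)

    +-comm : ∀ p q → p + q ≈ q + p
    +-comm (a / b [ _ ]) (u / v [ _ ]) = cross (solve 4
      (λ a b u v → (a :* v :+ u :* b) :* (v :* b) := (u :* b :+ a :* v) :* (b :* v))
      R.refl a b u v)

    +-assoc : ∀ p q r → (p + q) + r ≈ p + (q + r)
    +-assoc (a / b [ _ ]) (u / v [ _ ]) (s / t [ _ ]) = cross (solve 6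
      (λ a b u v s t →
        ((a :* v :+ u :* b) :* t :+ s :* (b :* v)) :* (b :* (v :* t))
        := (a :* (v :* t) :+ (u :* t :+ s :* v) :* b) :* ((b :* v) :* t))
      R.refl a b u v s t)

    +-identityˡ : ∀ p → embed 0# + p ≈ p
    +-identityˡ (a / b [ _ ]) = cross (solve 2
      (λ a b → (con 0 :* b :+ a :* con 1) :* b := a :* (con 1 :* b)) R.refl a b)

    neg-inverseˡ : ∀ p → - p + p ≈ embed 0#
    neg-inverseˡ (a / b [ _ ]) = cross (begin
      (R.- a R.* b R.+ a R.* b) R.* 1#
        ≈⟨ R.*-congʳ (R.trans (R.sym (R.distribʳ b (R.- a) a)) (R.*-congʳ (R.-‿inverseˡ a))) ⟩
      (0# R.* b) R.* 1#
        ≈⟨ solve 1 (λ b → (con 0 :* b) :* con 1 := con 0 :* (b :* b)) R.refl b ⟩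
      0# R.* (b R.* b) ∎)

    *-comm : ∀ p q → p * q ≈ q * p
    *-comm (a / b [ _ ]) (u / v [ _ ]) = cross (solve 4
      (λ a b u v → (a :* u) :* (v :* b) := (u :* a) :* (b :* v)) R.refl a b u v)

    *-assoc : ∀ p q r → (p * q) * r ≈ p * (q * r)
    *-assoc (a / b [ _ ]) (u / v [ _ ]) (s / t [ _ ]) = cross (solve 6
      (λ a b u v s t → ((a :* u) :* s) :* (b :* (v :* t)) := (a :* (u :* s)) :* ((b :* v) :* t))
      R.refl a b u v s t)

    *-identityˡ : ∀ p → embed 1# * p ≈ p
    *-identityˡ (a / b [ _ ]) = cross (solve 2
      (λ a b → (con 1 :* a) :* b := a :* (con 1 :* b)) R.refl a b)

    *-distribʳ : ∀ r p q → (p + q) * r ≈ p * r + q * r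
    *-distribʳ (s / t [ _ ]) (a / b [ _ ]) (u / v [ _ ]) = cross (solve 6
      (λ a b u v s t →
        ((a :* v :+ u :* b) :* s) :* ((b :* t) :* (v :* t))
        := ((a :* s) :* (v :* t) :+ (u :* s) :* (b :* t)) :* ((b :* v) :* t))
      R.refl a b u v s t)

  commutativeRing : CommutativeRing (c ⊔ ℓ) ℓ
  commutativeRing = record
    { Carrier = Fraction
    ; _≈_ = _≈_
    ; _+_ = _+_
    ; _*_ = _*_
    ; -_ = -_
    ; 0# = embed 0#
    ; 1# = embed 1#
    ; isCommutativeRing = record
      { isRing = record
        { +-isAbelianGroup = record
          { isGroup = record
            { isMonoid = record
              { isSemigroup = record
                { isMagma = record { isEquivalence = ≈-isEquivalence ; ∙-cong = +-cong }
                ; assoc = +-assoc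
                }
              ; identity = +-identityˡ , λ p → ≈-trans (+-comm p (embed 0#)) (+-identityˡ p)
              }
            ; inverse = neg-inverseˡ , λ p → ≈-trans (+-comm p (- p)) (neg-inverseˡ p)
            ; ⁻¹-cong = neg-cong
            }
          ; comm = +-comm
          }
        ; *-cong = *-cong
        ; *-assoc = *-assoc
        ; *-identity = *-identityˡ , λ p → ≈-trans (*-comm p (embed 1#)) (*-identityˡ p)
        ; distrib = (λ p q r → ≈-trans (*-comm p (q + r)) (≈-trans (*-distribʳ p q r)
                      (+-cong (*-comm q p) (*-comm r p))))
                  , *-distribʳ
        }
      ; *-comm = *-comm
      }
    }

  open CommutativeRing commutativeRing public using (_≉_)

  inverse : (p : Fraction) → p ≉ embed 0# → Fraction
  inverse (a / b [ b≉0 ]) p≉0 = b / a [ (λ a≈0 → p≉0 (cross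
    (R.trans (R.*-congʳ a≈0) (R.trans (R.zeroˡ 1#) (R.sym (R.zeroˡ b)))))) ]

  inverse-inverseʳ : ∀ p (p≉0 : p ≉ embed 0#) → p * inverse p p≉0 ≈ embed 1#
  inverse-inverseʳ (a / b [ _ ]) _ = cross (solve 2
    (λ a b → (a :* b) :* con 1 := con 1 :* (b :* a)) R.refl a b)

  embed-injective : ∀ {a b} → embed a ≈ embed b → a R.≈ b
  embed-injective (cross e) = R.*-cancelʳ R.1≉0 e

  embed-cong : ∀ {a b} → a R.≈ b → embed a ≈ embed b
  embed-cong a≈b = cross (R.*-congʳ a≈b)

-- ℤ[x,y] is taken as (ℤ[x])[y], and ℚ(x,y) as its field of fractions.

ℤ-integralDomain : IntegralDomain 0ℓ 0ℓ
ℤ-integralDomain = record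
  { commutativeRing = ℤₚ.+-*-commutativeRing
  ; 1≉0             = λ ()
  ; zeroProduct     = λ i j → ℤₚ.i*j≡0⇒i≡0∨j≡0 i
  }

module ℤ[x]    = Polynomials ℤ-integralDomain
module ℤ[x][y] = Polynomials ℤ[x].integralDomain

module ℤ[x,y] where
  open IntegralDomain ℤ[x][y].integralDomain public

  x y : Carrier
  x = ℤ[x][y].constant ℤ[x].X
  y = ℤ[x][y].X

module ℚ⟨x,y⟩ where
  open Fractions ℤ[x][y].integralDomain public
    using (embed; inverse; inverse-inverseʳ; embed-injective; embed-cong)
  open CommutativeRing (Fractions.commutativeRing ℤ[x][y].integralDomain) public
  open RawSemiringDefinitions (Semiring.rawSemiring semiring) public using (_^_) renaming (_×_ to _·_)

  x y : Carrier
  x = embed ℤ[x,y].x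
  y = embed ℤ[x,y].y

  -- The coefficient of x in x - 1 is nonzero.
  x-1≉0 : x - 1# ≉ 0#
  x-1≉0 e with Fractions.uncross e .ℤ[x][y].at 0 .ℤ[x].at 1
  ... | ()

  1/[x-1] : Carrier
  1/[x-1] = inverse (x - 1#) x-1≉0

-- The quotient of Fin n by the equivalence relation generated by R.
-- Surjectivity and `kernel` force `size` to be the number of classes.

record Quotient {n : ℕ} (R : Rel (Fin n) 0ℓ) : Set where
  field
    size       : ℕ
    class      : Fin n → Fin size
    surjective : Surjective _≡_ _≡_ class
    kernel     : ∀ u v → class u ≡ class v ⇔ EqClosure R u v

-- An edge of a multigraph is given by its pair of ends, in either order.
Edges : ℕ → ℕ → Set
Edges n m = Vec (Fin n × Fin n) m

Joined : Edges n m → Subset m → Rel (Fin n) 0ℓ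
Joined E A u v = ∃ λ e → e ∈ A × lookup E e ≡ (u , v)

private
  there-Joined : ∀ {E : Edges n m} {A s e u v} → Joined E A u v → Joined (e ∷ E) (s ∷ A) u v
  there-Joined (e , e∈A , eq) = suc e , there e∈A , eq

  -- `merge` identifies a with b: a is first moved onto b, then removed.
  module Merge {k : ℕ} {a b : Fin (suc k)} (a≢b : a ≢ b) where

    retract : Fin (suc k) → Fin (suc k)
    retract i with i ≟ᶠ a
    ... | yes _ = b
    ... | no  _ = i

    retract≢a : ∀ i → a ≢ retract i
    retract≢a i with i ≟ᶠ a
    ... | yes _  = a≢b
    ... | no i≢a = i≢a ∘ ≡.sym

    retract-a : retract a ≡ b
    retract-a with a ≟ᶠ a
    ... | yes _  = refl
    ... | no a≢a = ⊥-elim (a≢a refl)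

    retract-≢a : ∀ {i} → i ≢ a → retract i ≡ i
    retract-≢a {i} i≢a with i ≟ᶠ a
    ... | yes i≡a = ⊥-elim (i≢a i≡a)
    ... | no  _   = refl

    merge : Fin (suc k) → Fin k
    merge i = punchOut (retract≢a i)

    merge-cong : ∀ {i j} → retract i ≡ retract j → merge i ≡ merge j
    merge-cong eq = punchOut-cong a eq

    merge-injective : ∀ {i j} → merge i ≡ merge j → retract i ≡ retract j
    merge-injective {i} {j} eq = punchOut-injective (retract≢a i) (retract≢a j) eq

    merge-a≡b : merge a ≡ merge b
    merge-a≡b = merge-cong {a} {b} (≡.trans retract-a (≡.sym (retract-≢a (a≢b ∘ ≡.sym))))

    merge-punchIn : ∀ i → merge (punchIn a i) ≡ i
    merge-punchIn i = ≡.trans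
      (punchOut-cong a {i≢k = punchInᵢ≢i a i ∘ ≡.sym} (retract-≢a (punchInᵢ≢i a i)))
      (punchOut-punchIn a)

  mergeStep : ∀ (R R′ : Rel (Fin n) 0ℓ) {a b} →
              (∀ {u v} → R u v → R′ u v) → R′ a b →
              (∀ {u v} → R′ u v → (u , v) ≡ (a , b) ⊎ R u v) →
              Quotient R → Quotient R′
  mergeStep {n} R R′ {a} {b} R⊆R′ R′ab split
    record { size = size ; class = class ; surjective = surjective ; kernel = kernel } =
      go size class surjective kernel
    where
    open Equivalence

    go : ∀ k (f : Fin n → Fin k) → Surjective _≡_ _≡_ f →
         (∀ u v → f u ≡ f v ⇔ EqClosure R u v) → Quotient R′
    go zero f _ _ with () ← f a
    go (suc k) f surj ker with f a ≟ᶠ f b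
    ... | yes fa≡fb = record
      { size       = suc k
      ; class      = f
      ; surjective = surj
      ; kernel     = λ u v → mk⇔ (EqClosure.map R⊆R′ ∘ ker u v .to)
                       (EqClosure.gfold ≡.isEquivalence f respects)
      }
      where
      respects : ∀ {u v} → R′ u v → f u ≡ f v
      respects r with split r
      ... | inj₁ refl = fa≡fb
      ... | inj₂ r′   = ker _ _ .from (EqClosure.return r′)
    ... | no fa≢fb = record
      { size       = k
      ; class      = merge ∘ f
      ; surjective = λ i → let (u , eq) = surj (punchIn (f a) i) in
                       u , λ { refl → ≡.trans (cong merge (eq refl)) (merge-punchIn i) }
      ; kernel     = λ u v → mk⇔ (sound u v ∘ merge-injective {f u} {f v})
                       (EqClosure.gfold ≡.isEquivalence (merge ∘ f) respects)
      }
      where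
      open Merge fa≢fb

      lift : ∀ {u v} → f u ≡ f v → EqClosure R′ u v
      lift {u} {v} eq = EqClosure.map R⊆R′ (ker u v .to eq)

      a~b : EqClosure R′ a b
      a~b = EqClosure.return R′ab

      _■_ : ∀ {u v w} → EqClosure R′ u v → EqClosure R′ v w → EqClosure R′ u w
      _■_ = EqClosure.transitive R′

      flip : ∀ {u v} → EqClosure R′ u v → EqClosure R′ v u
      flip = EqClosure.symmetric R′

      sound : ∀ u v → retract (f u) ≡ retract (f v) → EqClosure R′ u v
      sound u v eq with f u ≟ᶠ f a | f v ≟ᶠ f a
      ... | yes p | yes q = lift (≡.trans p (≡.sym q))
      ... | yes p | no  _ = lift p ■ (a~b ■ lift eq)
      ... | no  _ | yes q = lift eq ■ (flip a~b ■ flip (lift q))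
      ... | no  _ | no  _ = lift eq

      respects : ∀ {u v} → R′ u v → merge (f u) ≡ merge (f v)
      respects r with split r
      ... | inj₁ refl = merge-a≡b
      ... | inj₂ r′   = cong merge (ker _ _ .from (EqClosure.return r′))

quotient : (E : Edges n m) (A : Subset m) → Quotient (Joined E A)
quotient {n} [] [] = record
  { size       = n
  ; class      = λ v → v
  ; surjective = λ v → v , λ eq → eq
  ; kernel     = λ u v → mk⇔ (λ { refl → EqClosure.reflexive (Joined [] []) })
                   (EqClosure.gfold {S = _≡_} ≡.isEquivalence (λ v → v) (λ { (() , _) }))
  }
quotient (e ∷ E) (outside ∷ A) = record
  { size       = size
  ; class      = class
  ; surjective = surjective
  ; kernel     = λ u v → mk⇔
      (EqClosure.map (there-Joined {E = E}) ∘ Equivalence.to (kernel u v))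
      (Equivalence.from (kernel u v) ∘
        EqClosure.map λ { (zero , () , _) ; (suc i , there i∈A , eq) → i , i∈A , eq })
  }
  where open Quotient (quotient E A)
quotient ((a , b) ∷ E) (inside ∷ A) =
  mergeStep (Joined E A) (Joined ((a , b) ∷ E) (inside ∷ A)) {a} {b}
    (there-Joined {E = E}) (zero , here , refl)
    (λ { (zero , here , eq) → inj₁ (≡.sym eq) ; (suc i , there i∈A , eq) → inj₂ (i , i∈A , eq) })
    (quotient E A)

-- A spanning subgraph is given by its edge set.

record Graph : Set where
  field
    ∣V∣   : ℕ
    ∣E∣   : ℕ
    edges : Edges ∣V∣ ∣E∣

module _ (G : Graph) where
  open Graph G

  SpanningSubgraph : Set
  SpanningSubgraph = Subset ∣E∣

  Connected : SpanningSubgraph → Rel (Fin ∣V∣) 0ℓ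
  Connected A = EqClosure (Joined edges A)

  connected? : ∀ A u v → Dec (Connected A u v)
  connected? A u v = map-dec (kernel u v) (class u ≟ᶠ class v)
    where open Quotient (quotient edges A)

  k : SpanningSubgraph → ℕ
  k A = Quotient.size (quotient edges A)

  -- None of the subtractions in r, nullity and weight truncates, since
  -- k(A) ≤ |V|, r(A) ≤ |E(A)| and r(A) ≤ r(G) for every A.
  r : SpanningSubgraph → ℕ
  r A = ∣V∣ ∸ k A

  nullity : SpanningSubgraph → ℕ
  nullity A = ∣ A ∣ ∸ r A

  weight : SpanningSubgraph → ℤ[x,y].Carrier
  weight A = (x - 1#) ^ (r ⊤ ∸ r A) * (y - 1#) ^ nullity A
    where open ℤ[x,y]

subsets : ∀ m → List (Subset m)
subsets zero    = [] ∷ []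
subsets (suc m) = List.map (outside ∷_) (subsets m) List.++ List.map (inside ∷_) (subsets m)

∑ : {A : Set} → List A → (A → ℤ[x,y].Carrier) → ℤ[x,y].Carrier
∑ as f = List.foldr ℤ[x,y]._+_ ℤ[x,y].0# (List.map f as)

Tutte : Graph → ℤ[x,y].Carrier
Tutte G = ∑ (subsets (Graph.∣E∣ G)) (weight G)

TutteOver : (G : Graph) {P : Pred (SpanningSubgraph G) 0ℓ} → Decidable P → ℤ[x,y].Carrier
TutteOver G P? = ∑ (List.filter P? (subsets (Graph.∣E∣ G))) (weight G)

record OutmostGraph : Set where
  field
    graph : Graph
  open Graph graph public
  field
    top left right : Fin ∣V∣

triangle : OutmostGraph
triangle = record
  { graph = record
    { ∣V∣   = 3
    ; ∣E∣   = 3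
    ; edges = (zero , suc zero) ∷ (zero , suc (suc zero)) ∷ (suc zero , suc (suc zero)) ∷ []
    }
  ; top   = zero
  ; left  = suc zero
  ; right = suc (suc zero)
  }

-- The vertex `combine i v` of the disjoint union of three copies of G is
-- the vertex v of the i-th copy. The vertices of the glued graph are the
-- classes of these under the identifications.
module Gluing (G : OutmostGraph) where
  open OutmostGraph G

  copy : Fin 3 → Fin ∣V∣ → Fin (3 *ℕ ∣V∣)
  copy = combine

  private
    G₁ G₂ G₃ : Fin ∣V∣ → Fin (3 *ℕ ∣V∣)
    G₁ = copy zero
    G₂ = copy (suc zero)
    G₃ = copy (suc (suc zero))

  copiedEdges : Edges (3 *ℕ ∣V∣) (3 *ℕ ∣E∣)
  copiedEdges = Vec.concat (Vec.tabulate λ i → Vec.map (map (copy i) (copy i)) edges)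

  identifications : Edges (3 *ℕ ∣V∣) 3
  identifications = (G₁ left  , G₂ top)
                  ∷ (G₁ right , G₃ top)
                  ∷ (G₂ right , G₃ left)
                  ∷ []

  open Quotient (quotient identifications ⊤) public

  glued : OutmostGraph
  glued = record
    { graph = record
      { ∣V∣   = size
      ; ∣E∣   = 3 *ℕ ∣E∣
      ; edges = Vec.map (map class class) copiedEdges
      }
    ; top   = class (G₁ top)
    ; left  = class (G₂ left)
    ; right = class (G₃ right)
    }

Γ : (n : ℕ) → .{{NonZero n}} → OutmostGraph
Γ (suc zero)      = triangle
Γ (suc n@(suc _)) = Gluing.glued (Γ n)

module _ (G : OutmostGraph) where
  open OutmostGraph G

  private
    _~[_]~_ : Fin ∣V∣ → SpanningSubgraph graph → Fin ∣V∣ → Set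
    u ~[ A ]~ v = Connected graph A u v

    dec : ∀ u A v → Dec (u ~[ A ]~ v)
    dec u A v = connected? graph A u v

  AllTogether TopApart AllApart : Pred (SpanningSubgraph graph) 0ℓ
  AllTogether A = (top ~[ A ]~ left) × (left ~[ A ]~ right)
  TopApart    A = (left ~[ A ]~ right) × ¬ (top ~[ A ]~ left)
  AllApart    A = ¬ (top ~[ A ]~ left) × ¬ (top ~[ A ]~ right) × ¬ (left ~[ A ]~ right)

  allTogether? : Decidable AllTogether
  allTogether? A = dec top A left ×-dec dec left A right

  topApart? : Decidable TopApart
  topApart? A = dec left A right ×-dec ¬? (dec top A left)

  allApart? : Decidable AllApart
  allApart? A = ¬? (dec top A left) ×-dec ¬? (dec top A right) ×-dec ¬? (dec left A right)

module _ (n : ℕ) .{{_ : NonZero n}} where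
  open OutmostGraph (Γ n) using (graph)

  T T₂ T₁ T₀ : ℤ[x,y].Carrier
  T  = Tutte graph
  T₂ = TutteOver graph (allTogether? (Γ n))
  T₁ = TutteOver graph (topApart? (Γ n))
  T₀ = TutteOver graph (allApart? (Γ n))

module Submission where

-- Record a spanning subgraph A of Γₙ by its pattern: which of the three
-- outmost vertices it connects. Since Γₙ is connected, the weight of A is
-- X^(k(A) - 1) Y^n(A), where X = x - 1 and Y = y - 1. A spanning subgraph of
-- Γₙ₊₁ is a triple of spanning subgraphs of Γₙ. The three identifications
-- lower the number of components by three, or by two when the triple closes
-- the cycle through the three copies, while |V| always drops by three. So the
-- weight of the triple is the product of the three weights times 1/X, or times
-- Y if the cycle closes, and both the pattern of the triple and the closing of
-- the cycle depend on the three patterns only. The recurrences are the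
-- resulting sums over the 125 triples of patterns. They treat the three
-- patterns with one apart vertex alike, so by induction these three have the
-- same sum T₁; no automorphism of Γₙ is needed.

open import Algebra.Bundles using (CommutativeRing; Semiring)
import Algebra.Definitions.RawSemiring as RawSemiringDefinitions
import Algebra.Properties.CommutativeSemigroup as CommutativeSemigroupProperties
import Algebra.Properties.Semiring.Exp as Exp
import Algebra.Solver.Ring.NaturalCoefficients.Default as SemiringSolver
open import Data.Bool.Base using (Bool; true; false; if_then_else_; _∧_; not)
open import Data.Fin.Base using (Fin; zero; suc; _↑ˡ_; _↑ʳ_; splitAt; join; combine)
open import Data.Fin.Properties using (_≟_; injective⇒≤; splitAt-↑ˡ; splitAt-↑ʳ; splitAt-join;
  join-splitAt)
open import Data.Fin.Subset using (Subset; inside; outside; ⊤; ∣_∣)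
open import Data.List.Base as List using (List; []; _∷_)
open import Data.Nat.Base as Nat using (ℕ; zero; suc; NonZero; _≤_; z≤n; s≤s; _∸_)
import Data.Nat.Properties as ℕₚ
open import Data.Nat.Solver using (module +-*-Solver)
open import Data.Product.Base as × using (∃; _×_; _,_; proj₁; proj₂)
open import Data.Sum.Base as ⊎ using (_⊎_; inj₁; inj₂)
open import Data.Sum.Properties using (inj₁-injective; inj₂-injective)
open import Data.Vec.Base as Vec using ([]; _∷_; _++_; here; there)
open import Data.Vec.Properties using (lookup-map; map-++; map-∘)
open import Function.Base using (_∘_; id)
open import Function.Bundles using (_⇔_; mk⇔; Equivalence)
open import Level using (0ℓ)
open import Relation.Binary.Core using (Rel)
open import Relation.Binary.Construct.Closure.Equivalence as EqClosure using (EqClosure)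
open import Relation.Binary.PropositionalEquality as ≡ using (_≡_; cong; cong₂; subst; module ≡-Reasoning)
import Relation.Binary.Reasoning.Setoid as SetoidReasoning
open import Relation.Nullary using (¬_; Dec; yes; no; does)
open import Relation.Nullary.Decidable as Dec using (does-⇔; dec-true; dec-false)
open import Relation.Unary using (Pred; Decidable)
open import Defs hiding (∑; weight)

module Combinatorics where
  open Nat using (_+_; _*_)
  open ℕₚ using (≤-antisym; ≤-refl; ≤-trans; ≤-reflexive; +-identityʳ; +-comm; +-assoc; +-suc;
    +-monoʳ-≤; +-cancelˡ-≡; m∸n+n≡m; m∸[m∸n]≡n; m+[n∸m]≡n; suc-injective; m≤n+o⇒m∸n≤o;
    module ≤-Reasoning)
  open ≡ using (refl; sym; trans; isEquivalence)
  open Equivalence using (to; from)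

  private
    variable
      n n′ m m′ : ℕ

  -- Connectivity of spanning subgraphs and the effect of adding one edge

  related? : {R : Rel (Fin n) 0ℓ} → Quotient R → ∀ u v → Dec (EqClosure R u v)
  related? Q u v = Dec.map (kernel u v) (class u ≟ class v)
    where open Quotient Q

  linked : Edges n m → Subset m → Fin n → Fin n → Bool
  linked E A u v = does (related? (quotient E A) u v)

  components : Edges n m → Subset m → ℕ
  components E A = Quotient.size (quotient E A)

  linked-refl : (E : Edges n m) (A : Subset m) → ∀ u → linked E A u u ≡ true
  linked-refl E A u = dec-true (related? (quotient E A) u u) (EqClosure.reflexive (Joined E A))

  linked-sym : (E : Edges n m) (A : Subset m) → ∀ u v → linked E A u v ≡ linked E A v u
  linked-sym E A u v = does-⇔ (mk⇔ (EqClosure.symmetric _) (EqClosure.symmetric _))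
    (related? (quotient E A) u v) (related? (quotient E A) v u)

  module Section {R : Rel (Fin n) 0ℓ} (Q : Quotient R) where
    open Quotient Q

    representative : Fin size → Fin n
    representative = proj₁ ∘ surjective

    class-representative : ∀ i → class (representative i) ≡ i
    class-representative i = proj₂ (surjective i) refl

    representative-class : ∀ u → EqClosure R (representative (class u)) u
    representative-class u = to (kernel _ u) (class-representative (class u))

  module _ {R : Rel (Fin n) 0ℓ} {R′ : Rel (Fin n′) 0ℓ}
           (Q : Quotient R) (Q′ : Quotient R′) (f : Fin n → Fin n′)
           (⇔f : ∀ u v → EqClosure R u v ⇔ EqClosure R′ (f u) (f v))
           (cover : ∀ w → ∃ λ u → EqClosure R′ w (f u))
           where
    private
      module Q = Quotient Q
      module Q′ = Quotient Q′
      open Section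

    -- Choosing representatives gives an injection of classes in each direction, since `f` preserves
    -- and reflects the relations and meets every class of `R′`.
    size-unique : Q.size ≡ Q′.size
    size-unique = ≤-antisym
      (injective⇒≤ {f = Q′.class ∘ f ∘ representative Q} λ {i} {j} eq →
        trans (sym (class-representative Q i))
          (trans (from (Q.kernel _ _) (from (⇔f _ _) (to (Q′.kernel _ _) eq)))
            (class-representative Q j)))
      (injective⇒≤ {f = Q.class ∘ proj₁ ∘ cover ∘ representative Q′} λ {i} {j} eq →
        trans (sym (class-representative Q′ i))
          (trans (from (Q′.kernel _ _)
            (trans′ (proj₂ (cover (representative Q′ i)))
              (trans′ (to (⇔f _ _) (to (Q.kernel _ _) eq))
                (EqClosure.symmetric R′ (proj₂ (cover (representative Q′ j)))))))
            (class-representative Q′ j)))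
      where trans′ = EqClosure.transitive R′

  -- u ~ v after adding the edge ab to L: compare u and v once the class of a is
  -- moved onto that of b.
  join-link : {S : Set} → S → S → (S → S → Bool) → S → S → Bool
  join-link a b L u v =
    if L u a then (if L v a then true else L b v) else (if L v a then L u b else L u v)

  module _ (E : Edges n m) (A : Subset m) (a b : Fin n) where
    private
      R  = Joined E A
      R′ = Joined ((a , b) ∷ E) (inside ∷ A)
      open Quotient (quotient E A)

      weaken : ∀ {u v} → R u v → R′ u v
      weaken (e , e∈A , eq) = suc e , there e∈A , eq

      -- A map into the old classes whose kernel is the new relation. `quotient` also renumbers the
      -- classes; comparing values of `retract` avoids following that.
      retract : Fin n → Fin size
      retract u = if does (class u ≟ class a) then class b else class u

      retract-cong : ∀ {u v} → class u ≡ class v → retract u ≡ retract v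
      retract-cong eq rewrite eq = refl

      retract-a : retract a ≡ class b
      retract-a rewrite dec-true (class a ≟ class a) refl = refl

      retract-b : retract b ≡ class b
      retract-b with class b ≟ class a
      ... | yes _ = refl
      ... | no _  = refl

      respects : ∀ {u v} → R′ u v → retract u ≡ retract v
      respects (zero  , here , refl)      = trans retract-a (sym retract-b)
      respects (suc e , there e∈A , refl) =
        retract-cong (from (kernel _ _) (EqClosure.return (e , e∈A , refl)))

      a~b : EqClosure R′ a b
      a~b = EqClosure.return (zero , here , refl)

      lift : ∀ {u v} → class u ≡ class v → EqClosure R′ u v
      lift eq = EqClosure.map weaken (to (kernel _ _) eq)

      ~retract : ∀ u → ∃ λ w → EqClosure R′ u w × class w ≡ retract u
      ~retract u with class u ≟ class a
      ... | yes eq = b , EqClosure.transitive R′ (lift eq) a~b , refl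
      ... | no  _  = u , EqClosure.reflexive R′ , refl

      retract-kernel : ∀ u v → EqClosure R′ u v ⇔ retract u ≡ retract v
      retract-kernel u v = mk⇔ (EqClosure.gfold isEquivalence retract respects) λ eq →
        let (w , u~w , p) = ~retract u
            (w′ , v~w′ , q) = ~retract v
        in EqClosure.transitive R′ u~w (EqClosure.transitive R′
             (lift (trans p (trans eq (sym q)))) (EqClosure.symmetric R′ v~w′))

    linked-∷ : ∀ u v → linked ((a , b) ∷ E) (inside ∷ A) u v ≡ join-link a b (linked E A) u v
    linked-∷ u v = trans
      (does-⇔ (retract-kernel u v) (related? (quotient ((a , b) ∷ E) (inside ∷ A)) u v)
        (retract u ≟ retract v))
      retract-link
      where
      retract-link : does (retract u ≟ retract v) ≡ join-link a b (linked E A) u v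
      retract-link with class u ≟ class a | class v ≟ class a
      ... | yes _ | yes _ = dec-true (class b ≟ class b) refl
      ... | yes _ | no  _ = refl
      ... | no  _ | yes _ = refl
      ... | no  _ | no  _ = refl

    -- `mergeStep` keeps the number of classes if those of `a` and `b` agree and removes one class
    -- otherwise. The change stands as a summand on the left, so that no subtraction occurs.
    components-∷ : components ((a , b) ∷ E) (inside ∷ A) + (if linked E A a b then 0 else 1)
                   ≡ components E A
    components-∷ with quotient E A
    ... | record { size = zero ; class = class } with () ← class a
    ... | record { size = suc k ; class = class } with class a ≟ class b
    ...   | yes _ = +-identityʳ _
    ...   | no  _ = +-comm k 1

  -- Disjoint unions

  infixr 5 _⊕_
  _⊕_ : Edges n m → Edges n′ m′ → Edges (n + n′) (m + m′)
  _⊕_ {n} {n′ = n′} E F =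
    Vec.map (×.map (_↑ˡ n′) (_↑ˡ n′)) E ++ Vec.map (×.map (n ↑ʳ_) (n ↑ʳ_)) F

  data Either (R : Rel (Fin n) 0ℓ) (S : Rel (Fin n′) 0ℓ) : Rel (Fin (n + n′)) 0ℓ where
    inˡ : ∀ {u v} → R u v → Either R S (u ↑ˡ n′) (v ↑ˡ n′)
    inʳ : ∀ {u v} → S u v → Either R S (n ↑ʳ u) (n ↑ʳ v)

  Joined-++⁻ : (E : Edges n m) (A : Subset m) (F : Edges n m′) (B : Subset m′) → ∀ {u v} →
               Joined (E ++ F) (A ++ B) u v → Joined E A u v ⊎ Joined F B u v
  Joined-++⁻ []      []      F B r                         = inj₂ r
  Joined-++⁻ (_ ∷ E) (_ ∷ A) F B (zero  , here     , eq) = inj₁ (zero , here , eq)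
  Joined-++⁻ (_ ∷ E) (_ ∷ A) F B (suc e , there e∈ , eq) =
    ⊎.map₁ (λ (e , e∈A , eq) → suc e , there e∈A , eq) (Joined-++⁻ E A F B (e , e∈ , eq))

  Joined-++⁺ˡ : (E : Edges n m) (A : Subset m) (F : Edges n m′) (B : Subset m′) → ∀ {u v} →
                Joined E A u v → Joined (E ++ F) (A ++ B) u v
  Joined-++⁺ˡ (_ ∷ E) (_ ∷ A) F B (zero  , here      , eq) = zero , here , eq
  Joined-++⁺ˡ (_ ∷ E) (_ ∷ A) F B (suc e , there e∈A , eq) =
    let (e , e∈ , eq) = Joined-++⁺ˡ E A F B (e , e∈A , eq) in suc e , there e∈ , eq

  Joined-++⁺ʳ : (E : Edges n m) (A : Subset m) (F : Edges n m′) (B : Subset m′) → ∀ {u v} →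
                Joined F B u v → Joined (E ++ F) (A ++ B) u v
  Joined-++⁺ʳ []      []      F B r = r
  Joined-++⁺ʳ (_ ∷ E) (_ ∷ A) F B r =
    let (e , e∈ , eq) = Joined-++⁺ʳ E A F B r in suc e , there e∈ , eq

  Joined-map⁺ : (f : Fin n → Fin n′) (E : Edges n m) (A : Subset m) → ∀ {u v} →
                Joined E A u v → Joined (Vec.map (×.map f f) E) A (f u) (f v)
  Joined-map⁺ f E A (e , e∈A , refl) = e , e∈A , lookup-map e (×.map f f) E

  Joined-map⁻ : (f : Fin n → Fin n′) (E : Edges n m) (A : Subset m) → ∀ {u v} →
                Joined (Vec.map (×.map f f) E) A u v →
                ∃ λ a → ∃ λ b → Joined E A a b × u ≡ f a × v ≡ f b
  Joined-map⁻ f E A (e , e∈A , refl) rewrite lookup-map e (×.map f f) E =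
    _ , _ , (e , e∈A , refl) , refl , refl

  module _ (E : Edges n m) (A : Subset m) (F : Edges n′ m′) (B : Subset m′) where
    private
      ιE : Edges (n + n′) m
      ιE = Vec.map (×.map (_↑ˡ n′) (_↑ˡ n′)) E

      κF : Edges (n + n′) m′
      κF = Vec.map (×.map (n ↑ʳ_) (n ↑ʳ_)) F

    Joined-⊕⁻ : ∀ {u v} → Joined (E ⊕ F) (A ++ B) u v → Either (Joined E A) (Joined F B) u v
    Joined-⊕⁻ j with Joined-++⁻ ιE A κF B j
    ... | inj₁ j′ with Joined-map⁻ (_↑ˡ n′) E A j′
    ...   | _ , _ , r , refl , refl = inˡ r
    Joined-⊕⁻ j | inj₂ j′ with Joined-map⁻ (n ↑ʳ_) F B j′
    ...   | _ , _ , r , refl , refl = inʳ r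

    Joined-⊕⁺ˡ : ∀ {u v} → Joined E A u v → Joined (E ⊕ F) (A ++ B) (u ↑ˡ n′) (v ↑ˡ n′)
    Joined-⊕⁺ˡ = Joined-++⁺ˡ ιE A κF B ∘ Joined-map⁺ (_↑ˡ n′) E A

    Joined-⊕⁺ʳ : ∀ {u v} → Joined F B u v → Joined (E ⊕ F) (A ++ B) (n ↑ʳ u) (n ↑ʳ v)
    Joined-⊕⁺ʳ = Joined-++⁺ʳ ιE A κF B ∘ Joined-map⁺ (n ↑ʳ_) F B

  module _ (E : Edges n m) (A : Subset m) (F : Edges n′ m′) (B : Subset m′) where
    private
      R = Joined (E ⊕ F) (A ++ B)
      module Q₁ = Quotient (quotient E A)
      module Q₂ = Quotient (quotient F B)

      -- In a sum type the constructors tell the two sides apart; the classes are numbered only in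
      -- `quotient⊎`.
      class⊎ : Fin (n + n′) → Fin Q₁.size ⊎ Fin Q₂.size
      class⊎ w = ⊎.map Q₁.class Q₂.class (splitAt n w)

      class⊎-↑ˡ : ∀ u → class⊎ (u ↑ˡ n′) ≡ inj₁ (Q₁.class u)
      class⊎-↑ˡ u = cong (⊎.map Q₁.class Q₂.class) (splitAt-↑ˡ n u n′)

      class⊎-↑ʳ : ∀ v → class⊎ (n ↑ʳ v) ≡ inj₂ (Q₂.class v)
      class⊎-↑ʳ v = cong (⊎.map Q₁.class Q₂.class) (splitAt-↑ʳ n n′ v)

      respects : ∀ {w w′} → R w w′ → class⊎ w ≡ class⊎ w′
      respects r with Joined-⊕⁻ E A F B r
      ... | inˡ {u} {v} s = trans (class⊎-↑ˡ u)
        (trans (cong inj₁ (from (Q₁.kernel u v) (EqClosure.return s))) (sym (class⊎-↑ˡ v)))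
      ... | inʳ {u} {v} s = trans (class⊎-↑ʳ u)
        (trans (cong inj₂ (from (Q₂.kernel u v) (EqClosure.return s))) (sym (class⊎-↑ʳ v)))

      lower : ∀ {w w′} → EqClosure R w w′ → class⊎ w ≡ class⊎ w′
      lower = EqClosure.gfold isEquivalence class⊎ respects

      liftˡ : ∀ {u v} → EqClosure (Joined E A) u v → EqClosure R (u ↑ˡ n′) (v ↑ˡ n′)
      liftˡ = EqClosure.gmap (_↑ˡ n′) (Joined-⊕⁺ˡ E A F B)

      liftʳ : ∀ {u v} → EqClosure (Joined F B) u v → EqClosure R (n ↑ʳ u) (n ↑ʳ v)
      liftʳ = EqClosure.gmap (n ↑ʳ_) (Joined-⊕⁺ʳ E A F B)

      sound : ∀ s t → ⊎.map Q₁.class Q₂.class s ≡ ⊎.map Q₁.class Q₂.class t →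
              EqClosure R (join n n′ s) (join n n′ t)
      sound (inj₁ u) (inj₁ v) eq = liftˡ (to (Q₁.kernel u v) (inj₁-injective eq))
      sound (inj₂ u) (inj₂ v) eq = liftʳ (to (Q₂.kernel u v) (inj₂-injective eq))

      injective : ∀ {i j} → join Q₁.size Q₂.size i ≡ join Q₁.size Q₂.size j → i ≡ j
      injective {i} {j} eq = trans (sym (splitAt-join Q₁.size Q₂.size i))
        (trans (cong (splitAt Q₁.size) eq) (splitAt-join Q₁.size Q₂.size j))

      representative : ∀ i → ∃ λ w → class⊎ w ≡ i
      representative (inj₁ i) = let u = Section.representative (quotient E A) i in
        u ↑ˡ n′ , trans (class⊎-↑ˡ u) (cong inj₁ (Section.class-representative (quotient E A) i))
      representative (inj₂ i) = let u = Section.representative (quotient F B) i in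
        n ↑ʳ u , trans (class⊎-↑ʳ u) (cong inj₂ (Section.class-representative (quotient F B) i))

      quotient⊎ : Quotient R
      quotient⊎ = record
        { size       = Q₁.size + Q₂.size
        ; class      = join Q₁.size Q₂.size ∘ class⊎
        ; surjective = λ i → let (w , eq) = representative (splitAt Q₁.size i) in
            w , λ { refl → trans (cong (join Q₁.size Q₂.size) eq) (join-splitAt Q₁.size Q₂.size i) }
        ; kernel     = λ w w′ → mk⇔
            -- Both vertices are rewritten as `join` of their `splitAt`, the form that `sound`
            -- handles.
            (λ eq → subst (λ z → EqClosure R z w′) (join-splitAt n n′ w)
              (subst (EqClosure R _) (join-splitAt n n′ w′) 
                (sound (splitAt n w) (splitAt n w′) (injective {class⊎ w} {class⊎ w′} eq))))
            (cong (join Q₁.size Q₂.size) ∘ lower)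
        }

    -- Any two quotients by one relation have equally many classes, so the explicit `quotient⊎` may
    -- stand in for the one computed edge by edge.
    components-⊕ : components (E ⊕ F) (A ++ B) ≡ components E A + components F B
    components-⊕ = size-unique (quotient (E ⊕ F) (A ++ B)) quotient⊎ id
      (λ u v → mk⇔ id id) (λ w → w , EqClosure.reflexive R)

    linked-⊕-↑ˡ : ∀ u v → linked (E ⊕ F) (A ++ B) (u ↑ˡ n′) (v ↑ˡ n′) ≡ linked E A u v
    linked-⊕-↑ˡ u v = does-⇔ (mk⇔
      (λ u~v → to (Q₁.kernel u v) (inj₁-injective
        (trans (sym (class⊎-↑ˡ u)) (trans (lower u~v) (class⊎-↑ˡ v)))))
      liftˡ) (related? (quotient (E ⊕ F) (A ++ B)) _ _) (related? (quotient E A) u v)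

    linked-⊕-↑ʳ : ∀ u v → linked (E ⊕ F) (A ++ B) (n ↑ʳ u) (n ↑ʳ v) ≡ linked F B u v
    linked-⊕-↑ʳ u v = does-⇔ (mk⇔
      (λ u~v → to (Q₂.kernel u v) (inj₂-injective
        (trans (sym (class⊎-↑ʳ u)) (trans (lower u~v) (class⊎-↑ʳ v)))))
      liftʳ) (related? (quotient (E ⊕ F) (A ++ B)) _ _) (related? (quotient F B) u v)

    unlinked-⊕ : ∀ u v → linked (E ⊕ F) (A ++ B) (u ↑ˡ n′) (n ↑ʳ v) ≡ false
    unlinked-⊕ u v = dec-false (related? (quotient (E ⊕ F) (A ++ B)) (u ↑ˡ n′) (n ↑ʳ v))
      λ u~v → case (trans (sym (class⊎-↑ˡ u)) (trans (lower u~v) (class⊎-↑ʳ v)))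
      where
      case : ∀ {i j} → ¬ (inj₁ i ≡ inj₂ j)
      case ()

  -- Patterns of the outmost vertices and their gluing

  data Corner : Set where
    topᶜ leftᶜ rightᶜ : Corner

  data Pattern : Set where
    together allApart : Pattern
    apart             : Corner → Pattern

  -- Whether top ~ left, top ~ right and left ~ right.
  code : Pattern → Bool × Bool × Bool
  code together       = true  , true  , true
  code (apart topᶜ)   = false , false , true
  code (apart leftᶜ)  = false , true  , false
  code (apart rightᶜ) = true  , false , false
  code allApart       = false , false , false

  entry : Bool × Bool × Bool → Corner → Corner → Bool
  entry (tl , tr , lr) topᶜ   leftᶜ  = tl
  entry (tl , tr , lr) topᶜ   rightᶜ = tr
  entry (tl , tr , lr) leftᶜ  rightᶜ = lr
  entry (tl , tr , lr) leftᶜ  topᶜ   = tl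
  entry (tl , tr , lr) rightᶜ topᶜ   = tr
  entry (tl , tr , lr) rightᶜ leftᶜ  = lr
  entry (tl , tr , lr) topᶜ   topᶜ   = true
  entry (tl , tr , lr) leftᶜ  leftᶜ  = true
  entry (tl , tr , lr) rightᶜ rightᶜ = true

  links : Pattern → Corner → Corner → Bool
  links p = entry (code p)

  -- Triples with exactly two true entries come from no equivalence relation. Their values are
  -- chosen to agree with the predicates `AllTogether`, `TopApart` and `AllApart`, which test only
  -- some of the entries.
  classify : (top~left top~right left~right : Bool) → Pattern
  classify true  _     true  = together
  classify true  _     false = apart rightᶜ
  classify false _     true  = apart topᶜ
  classify false true  false = apart leftᶜ
  classify false false false = allApart

  partition : (Corner → Corner → Bool) → Pattern
  partition L = classify (L topᶜ leftᶜ) (L topᶜ rightᶜ) (L leftᶜ rightᶜ)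

  Site : Set
  Site = Fin 3 × Corner

  pattern G₁ = zero
  pattern G₂ = suc zero
  pattern G₃ = suc (suc zero)

  -- Every identified vertex and every new outmost vertex is a corner of a copy, so these nine sites
  -- carry all that gluing needs, and the result evaluates once the patterns are known.
  blocks : Pattern → Pattern → Pattern → Site → Site → Bool
  blocks p q s (G₁ , c) (G₁ , d) = links p c d
  blocks p q s (G₂ , c) (G₂ , d) = links q c d
  blocks p q s (G₃ , c) (G₃ , d) = links s c d
  blocks p q s _        _        = false

  -- The identifications in the order in which `quotient` carries them out.
  glue₁ glue₂ glue₃ : (Site → Site → Bool) → Site → Site → Bool
  glue₁ = join-link (G₂ , rightᶜ) (G₃ , leftᶜ)
  glue₂ = join-link (G₁ , rightᶜ) (G₃ , topᶜ) ∘ glue₁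
  glue₃ = join-link (G₁ , leftᶜ) (G₂ , topᶜ) ∘ glue₂

  outmost : Corner → Site
  outmost topᶜ   = G₁ , topᶜ
  outmost leftᶜ  = G₂ , leftᶜ
  outmost rightᶜ = G₃ , rightᶜ

  glue : Pattern → Pattern → Pattern → Pattern
  glue p q s = partition λ c d → glue₃ (blocks p q s) (outmost c) (outmost d)

  -- Whether the last identification joins two vertices that are connected already.
  closed : Pattern → Pattern → Pattern → Bool
  closed p q s = glue₂ (blocks p q s) (G₁ , leftᶜ) (G₂ , topᶜ)

  -- The hypotheses are transitivity through top, left and right; they exclude exactly the triples
  -- with two true entries, where `classify` loses information.
  code-classify : ∀ x y z →
                  (x ≡ true → y ≡ true → z ≡ true) →
                  (x ≡ true → z ≡ true → y ≡ true) →
                  (y ≡ true → z ≡ true → x ≡ true) →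
                  code (classify x y z) ≡ (x , y , z)
  code-classify true  true  true  f g h = refl
  code-classify true  true  false f g h with () ← f refl refl
  code-classify true  false true  f g h with () ← g refl refl
  code-classify true  false false f g h = refl
  code-classify false true  true  f g h with () ← h refl refl
  code-classify false true  false f g h = refl
  code-classify false false true  f g h = refl
  code-classify false false false f g h = refl

  from-does : {P : Set} (P? : Dec P) → does P? ≡ true → P
  from-does (yes p) _ = p

  module _ (E : Edges n m) (A : Subset m) where

    linked-trans : ∀ u v w → linked E A u v ≡ true → linked E A v w ≡ true → linked E A u w ≡ true
    linked-trans u v w p q = dec-true (related? (quotient E A) u w)
      (EqClosure.transitive (Joined E A) (sound u v p) (sound v w q))
      where
      sound : ∀ u v → linked E A u v ≡ true → EqClosure (Joined E A) u v
      sound u v = from-does (related? (quotient E A) u v)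

    -- Being linked is an equivalence relation, so three of the nine entries determine the rest.
    -- This lets the pattern stand in for the subgraph from here on.
    linked-links : ∀ (corner : Corner → Fin n) c d →
                   linked E A (corner c) (corner d) ≡
                   links (partition λ c d → linked E A (corner c) (corner d)) c d
    linked-links corner c d = trans (upper c d) (cong (λ t → entry t c d) (sym
      (code-classify (L topᶜ leftᶜ) (L topᶜ rightᶜ) (L leftᶜ rightᶜ)
        (λ tl tr → via topᶜ (trans (L-sym leftᶜ topᶜ) tl) tr)
        (λ tl lr → via leftᶜ tl lr)
        (λ tr lr → via rightᶜ tr (trans (L-sym rightᶜ leftᶜ) lr)))))
      where
      L : Corner → Corner → Bool
      L c d = linked E A (corner c) (corner d)

      L-sym : ∀ c d → L c d ≡ L d c
      L-sym c d = linked-sym E A (corner c) (corner d)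

      via : ∀ {b d} c → L b c ≡ true → L c d ≡ true → L b d ≡ true
      via c = linked-trans _ (corner c) _

      upper : ∀ c d → L c d ≡ entry (L topᶜ leftᶜ , L topᶜ rightᶜ , L leftᶜ rightᶜ) c d
      upper topᶜ   leftᶜ  = refl
      upper topᶜ   rightᶜ = refl
      upper leftᶜ  rightᶜ = refl
      upper leftᶜ  topᶜ   = L-sym leftᶜ topᶜ
      upper rightᶜ topᶜ   = L-sym rightᶜ topᶜ
      upper rightᶜ leftᶜ  = L-sym rightᶜ leftᶜ
      upper topᶜ   topᶜ   = linked-refl E A _
      upper leftᶜ  leftᶜ  = linked-refl E A _
      upper rightᶜ rightᶜ = linked-refl E A _

  -- `join-link` reads `L` only at pairs of its own arguments, so it commutes with pulling back
  -- along `f`. Hence gluing can be followed on sites instead of vertices.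
  join-link-cong : {S U : Set} (f : S → U) (a b : S) (L : U → U → Bool) (M : S → S → Bool) →
                   (∀ s t → L (f s) (f t) ≡ M s t) →
                   ∀ s t → join-link (f a) (f b) L (f s) (f t) ≡ join-link a b M s t
  join-link-cong f a b L M eq s t rewrite eq s a | eq t a | eq b t | eq s b | eq s t = refl

  linked-∷-along : {S : Set} (f : S → Fin n) (E : Edges n m) (A : Subset m) (M : S → S → Bool)
                   (a b : S) → (∀ s t → linked E A (f s) (f t) ≡ M s t) →
                   ∀ s t → linked ((f a , f b) ∷ E) (inside ∷ A) (f s) (f t) ≡ join-link a b M s t
  linked-∷-along f E A M a b eq s t = trans (linked-∷ E A (f a) (f b) (f s) (f t))
    (join-link-cong f a b (linked E A) M eq s t)

  -- Three copies, with the identifications as additional edges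

  module Copies (E : Edges n m) (A₁ A₂ A₃ : Subset m) (corner : Corner → Fin n) where

    copies : Edges (3 * n) (3 * m)
    copies = Vec.concat (Vec.tabulate λ i → Vec.map (×.map (combine {3} i) (combine i)) E)

    -- The final `[]` matches `3 * m`, which unfolds to `m + (m + (m + 0))`.
    A : Subset (3 * m)
    A = A₁ ++ (A₂ ++ (A₃ ++ []))

    site : Site → Fin (3 * n)
    site (i , c) = combine i (corner c)

    -- Identifying two vertices has the same effect on connectivity as joining them by an edge, and
    -- the effect of an edge is known from `linked-∷` and `components-∷`.
    identified : Edges (3 * n) 3
    identified = (site (G₁ , leftᶜ)  , site (G₂ , topᶜ))
               ∷ (site (G₁ , rightᶜ) , site (G₃ , topᶜ))
               ∷ (site (G₂ , rightᶜ) , site (G₃ , leftᶜ))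
               ∷ []

    patternOf : Subset m → Pattern
    patternOf B = partition λ c d → linked E B (corner c) (corner d)

    private
      -- For a fixed copy `combine` unfolds to nested injections into the summands, so it only
      -- remains to move the maps across `++`.
      copies-⊕ : copies ≡ E ⊕ E ⊕ E ⊕ []
      copies-⊕ = cong (Vec.map (×.map (combine {3} G₁) (combine {3} G₁)) E ++_) (sym (begin
        Vec.map κ (Vec.map ι E ++ Vec.map κ′ (Vec.map ι′ E ++ []))
          ≡⟨ map-++ κ (Vec.map ι E) _ ⟩
        Vec.map κ (Vec.map ι E) ++ Vec.map κ (Vec.map κ′ (Vec.map ι′ E ++ []))
          ≡⟨ cong₂ _++_ (sym (map-∘ κ ι E))
               (trans (sym (map-∘ κ κ′ _)) (map-++ (κ ∘ κ′) (Vec.map ι′ E) [])) ⟩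
        Vec.map (κ ∘ ι) E ++ (Vec.map (κ ∘ κ′) (Vec.map ι′ E) ++ [])
          ≡⟨ cong (λ F → Vec.map (κ ∘ ι) E ++ (F ++ [])) (map-∘ (κ ∘ κ′) ι′ E) ⟨
        Vec.map (κ ∘ ι) E ++ (Vec.map (κ ∘ κ′ ∘ ι′) E ++ []) ∎))
        where
        open ≡-Reasoning
        κ  : Fin (n + (n + 0)) × Fin (n + (n + 0)) → Fin (n + (n + (n + 0))) × Fin (n + (n + (n + 0)))
        κ  = ×.map (n ↑ʳ_) (n ↑ʳ_)
        κ′ : Fin (n + 0) × Fin (n + 0) → Fin (n + (n + 0)) × Fin (n + (n + 0))
        κ′ = ×.map (n ↑ʳ_) (n ↑ʳ_)
        ι : Fin n × Fin n → Fin (n + (n + 0)) × Fin (n + (n + 0))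
        ι  = ×.map (_↑ˡ (n + 0)) (_↑ˡ (n + 0))
        ι′ : Fin n × Fin n → Fin (n + 0) × Fin (n + 0)
        ι′ = ×.map (_↑ˡ 0) (_↑ˡ 0)

    block : Site → Site → Bool
    block = blocks (patternOf A₁) (patternOf A₂) (patternOf A₃)

    private
      linked-⊕-blocks : ∀ s t → linked (E ⊕ E ⊕ E ⊕ []) A (site s) (site t) ≡ block s t
      linked-⊕-blocks (G₁ , c) (G₁ , d) = trans
        (linked-⊕-↑ˡ E A₁ (E ⊕ E ⊕ []) _ (corner c) (corner d)) (linked-links E A₁ corner c d)
      linked-⊕-blocks (G₂ , c) (G₂ , d) = trans
        (linked-⊕-↑ʳ E A₁ (E ⊕ E ⊕ []) _ _ _) (trans
        (linked-⊕-↑ˡ E A₂ (E ⊕ []) _ (corner c) (corner d)) (linked-links E A₂ corner c d))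
      linked-⊕-blocks (G₃ , c) (G₃ , d) = trans
        (linked-⊕-↑ʳ E A₁ (E ⊕ E ⊕ []) _ _ _) (trans
        (linked-⊕-↑ʳ E A₂ (E ⊕ []) _ _ _) (trans
        (linked-⊕-↑ˡ E A₃ [] [] (corner c) (corner d)) (linked-links E A₃ corner c d)))
      linked-⊕-blocks (G₁ , c) (G₂ , d) = unlinked-⊕ E A₁ (E ⊕ E ⊕ []) _ _ _
      linked-⊕-blocks (G₁ , c) (G₃ , d) = unlinked-⊕ E A₁ (E ⊕ E ⊕ []) _ _ _
      linked-⊕-blocks (G₂ , c) (G₃ , d) = trans
        (linked-⊕-↑ʳ E A₁ (E ⊕ E ⊕ []) _ _ _) (unlinked-⊕ E A₂ (E ⊕ []) _ _ _)
      linked-⊕-blocks s@(G₂ , c) t@(G₁ , d) = trans (linked-sym (E ⊕ E ⊕ E ⊕ []) A (site s) (site t))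
        (linked-⊕-blocks t s)
      linked-⊕-blocks s@(G₃ , c) t@(G₁ , d) = trans (linked-sym (E ⊕ E ⊕ E ⊕ []) A (site s) (site t))
        (linked-⊕-blocks t s)
      linked-⊕-blocks s@(G₃ , c) t@(G₂ , d) = trans (linked-sym (E ⊕ E ⊕ E ⊕ []) A (site s) (site t))
        (linked-⊕-blocks t s)

      linked-copies : ∀ s t → linked copies A (site s) (site t) ≡ block s t
      linked-copies s t = trans (cong (λ F → linked F A (site s) (site t)) copies-⊕) (linked-⊕-blocks s t)

      components-copies : components copies A ≡ components E A₁ + (components E A₂ + components E A₃)
      components-copies = begin
        components copies A                      ≡⟨ cong (λ F → components F A) copies-⊕ ⟩
        components (E ⊕ E ⊕ E ⊕ []) A            ≡⟨ components-⊕ E A₁ _ _ ⟩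
        components E A₁ + components (E ⊕ E ⊕ []) (A₂ ++ A₃ ++ [])
          ≡⟨ cong (components E A₁ +_) (components-⊕ E A₂ _ _) ⟩
        components E A₁ + (components E A₂ + components (E ⊕ []) (A₃ ++ []))
          -- The last summand is the graph without vertices, which has no components.
          ≡⟨ cong (λ k → components E A₁ + (components E A₂ + k))
               (trans (components-⊕ E A₃ [] []) (+-identityʳ _)) ⟩
        components E A₁ + (components E A₂ + components E A₃) ∎
        where open ≡-Reasoning

    private
      F₁ : Edges (3 * n) (1 + 3 * m)
      F₁ = (site (G₂ , rightᶜ) , site (G₃ , leftᶜ)) ∷ copies
      F₂ : Edges (3 * n) (2 + 3 * m)
      F₂ = (site (G₁ , rightᶜ) , site (G₃ , topᶜ)) ∷ F₁

      linked-glued₁ : ∀ s t → linked F₁ (inside ∷ A) (site s) (site t) ≡ glue₁ block s t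
      linked-glued₁ = linked-∷-along site copies A block (G₂ , rightᶜ) (G₃ , leftᶜ) linked-copies

      linked-glued₂ : ∀ s t → linked F₂ (inside ∷ inside ∷ A) (site s) (site t) ≡ glue₂ block s t
      linked-glued₂ = linked-∷-along site F₁ (inside ∷ A) (glue₁ block) (G₁ , rightᶜ) (G₃ , topᶜ) linked-glued₁

    linked-glued : ∀ s t → linked (identified ++ copies) (⊤ {3} ++ A) (site s) (site t) ≡ glue₃ block s t
    linked-glued = linked-∷-along site F₂ (inside ∷ inside ∷ A) (glue₂ block) (G₁ , leftᶜ) (G₂ , topᶜ) linked-glued₂

    -- The first two identifications always merge two components: at that stage the sites involved
    -- are unlinked whatever the patterns are. Only the third can close the cycle.
    components-glued : components (identified ++ copies) (⊤ {3} ++ A)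
                       + (if closed (patternOf A₁) (patternOf A₂) (patternOf A₃) then 0 else 1) + 1 + 1
                       ≡ components E A₁ + (components E A₂ + components E A₃)
    components-glued = begin
      components (identified ++ copies) (⊤ {3} ++ A)
        + (if closed (patternOf A₁) (patternOf A₂) (patternOf A₃) then 0 else 1) + 1 + 1
        ≡⟨ cong (λ b → components (identified ++ copies) (⊤ {3} ++ A) + (if b then 0 else 1) + 1 + 1)
             (linked-glued₂ (G₁ , leftᶜ) (G₂ , topᶜ)) ⟨
      components (identified ++ copies) (⊤ {3} ++ A)
        + (if linked F₂ (inside ∷ inside ∷ A) (site (G₁ , leftᶜ)) (site (G₂ , topᶜ)) then 0 else 1) + 1 + 1
        ≡⟨ cong (λ k → k + 1 + 1) (components-∷ F₂ (inside ∷ inside ∷ A) _ _) ⟩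
      components F₂ (inside ∷ inside ∷ A) + 1 + 1
        -- The entry of `glue₁ block` at these sites evaluates to `false`, which yields the constant
        -- 1; the entry of `block` does so for the first identification.
        ≡⟨ cong (λ b → components F₂ (inside ∷ inside ∷ A) + (if b then 0 else 1) + 1)
             (linked-glued₁ (G₁ , rightᶜ) (G₃ , topᶜ)) ⟨
      components F₂ (inside ∷ inside ∷ A)
        + (if linked F₁ (inside ∷ A) (site (G₁ , rightᶜ)) (site (G₃ , topᶜ)) then 0 else 1) + 1
        ≡⟨ cong (_+ 1) (components-∷ F₁ (inside ∷ A) _ _) ⟩
      components F₁ (inside ∷ A) + 1
        ≡⟨ cong (λ b → components F₁ (inside ∷ A) + (if b then 0 else 1))
             (linked-copies (G₂ , rightᶜ) (G₃ , leftᶜ)) ⟨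
      components F₁ (inside ∷ A)
        + (if linked copies A (site (G₂ , rightᶜ)) (site (G₃ , leftᶜ)) then 0 else 1)
        ≡⟨ components-∷ copies A _ _ ⟩
      components copies A
        ≡⟨ components-copies ⟩
      components E A₁ + (components E A₂ + components E A₃) ∎
      where open ≡-Reasoning

  -- Contracting the identifications

  module Contraction (I : Edges n m) (F : Edges n m′) (A : Subset m′) where
    open Quotient (quotient I ⊤)

    private
      R  = Joined (I ++ F) (⊤ ++ A)
      R′ = Joined (Vec.map (×.map class class) F) A
      open Section (quotient I ⊤)

      respects : ∀ {u v} → R u v → EqClosure R′ (class u) (class v)
      respects j with Joined-++⁻ I ⊤ F A j
      ... | inj₁ i = subst (EqClosure R′ _) (from (kernel _ _) (EqClosure.return i))
                       (EqClosure.reflexive R′)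
      ... | inj₂ f = EqClosure.return (Joined-map⁺ class F A f)

      identified⇒ : ∀ {u v} → EqClosure (Joined I ⊤) u v → EqClosure R u v
      identified⇒ = EqClosure.map (Joined-++⁺ˡ I ⊤ F A)

      unclass : ∀ {i j} → R′ i j → EqClosure R (representative i) (representative j)
      unclass j with Joined-map⁻ class F A j
      ... | a , b , f , refl , refl = EqClosure.transitive R (identified⇒ (representative-class a))
        (EqClosure.transitive R (EqClosure.return (Joined-++⁺ʳ I ⊤ F A f))
          (EqClosure.symmetric R (identified⇒ (representative-class b))))

      -- Forwards, edges of `I` become equalities and edges of `F` stay edges. Backwards, an edge
      -- between classes lifts to one of `F`, whose ends are connected to the chosen representatives
      -- through `I`.
      ⇔class : ∀ u v → EqClosure R u v ⇔ EqClosure R′ (class u) (class v)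
      ⇔class u v = mk⇔
        (EqClosure.gfold (EqClosure.isEquivalence R′) class respects)
        λ eq → EqClosure.transitive R (EqClosure.symmetric R (identified⇒ (representative-class u)))
          (EqClosure.transitive R
            (EqClosure.gfold (EqClosure.isEquivalence R) representative unclass eq)
            (identified⇒ (representative-class v)))

    components-contract : components (Vec.map (×.map class class) F) A ≡ components (I ++ F) (⊤ ++ A)
    components-contract = sym (size-unique
      (quotient (I ++ F) (⊤ ++ A)) (quotient (Vec.map (×.map class class) F) A) class ⇔class λ w →
        representative w , subst (EqClosure R′ w) (sym (class-representative w)) (EqClosure.reflexive R′))

    linked-contract : ∀ u v → linked (Vec.map (×.map class class) F) A (class u) (class v)
                              ≡ linked (I ++ F) (⊤ ++ A) u v
    linked-contract u v = sym (does-⇔ (⇔class u v) (related? (quotient (I ++ F) (⊤ ++ A)) u v)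
      (related? (quotient (Vec.map (×.map class class) F) A) (class u) (class v)))

  -- Rank and nullity without truncated subtraction

  components≤∣V∣ : (E : Edges n m) (A : Subset m) → components E A ≤ n
  components≤∣V∣ E A = injective⇒≤ {f = representative} λ {i} {j} eq →
    trans (sym (class-representative i)) (trans (cong class eq) (class-representative j))
    where
    open Quotient (quotient E A)
    open Section (quotient E A)

  -- Each edge lowers the number of components by at most one, starting from one component per
  -- vertex. This bounds the rank by the number of edges, as `nullity` requires.
  ∣V∣≤∣A∣+components : (E : Edges n m) (A : Subset m) → n ≤ ∣ A ∣ + components E A
  ∣V∣≤∣A∣+components []      []            = ≤-refl
  ∣V∣≤∣A∣+components (_ ∷ E) (outside ∷ A) = ∣V∣≤∣A∣+components E A
  ∣V∣≤∣A∣+components {n} ((a , b) ∷ E) (inside ∷ A) = begin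
    n                                        ≤⟨ ∣V∣≤∣A∣+components E A ⟩
    ∣ A ∣ + components E A                   ≡⟨ cong (∣ A ∣ +_) (components-∷ E A a b) ⟨
    ∣ A ∣ + (c + (if linked E A a b then 0 else 1))  ≤⟨ +-monoʳ-≤ ∣ A ∣ (+-monoʳ-≤ c (bit≤1 (linked E A a b))) ⟩
    ∣ A ∣ + (c + 1)                          ≡⟨ cong (∣ A ∣ +_) (+-comm c 1) ⟩
    ∣ A ∣ + suc c                            ≡⟨ +-suc ∣ A ∣ c ⟩
    suc ∣ A ∣ + c                            ∎
    where
    open ≤-Reasoning
    c = components ((a , b) ∷ E) (inside ∷ A)
    bit≤1 : ∀ b → (if b then 0 else 1) ≤ 1
    bit≤1 true  = z≤n
    bit≤1 false = ≤-refl

  ∣++∣ : (A : Subset m) (B : Subset m′) → ∣ A ++ B ∣ ≡ ∣ A ∣ + ∣ B ∣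
  ∣++∣ []            B = refl
  ∣++∣ (outside ∷ A) B = ∣++∣ A B
  ∣++∣ (inside  ∷ A) B = cong suc (∣++∣ A B)

  ⊤-++ : ∀ m {m′} → ⊤ {m + m′} ≡ ⊤ {m} ++ ⊤ {m′}
  ⊤-++ zero    = refl
  ⊤-++ (suc m) = cong (inside ∷_) (⊤-++ m)

  corner : (G : OutmostGraph) → Corner → Fin (OutmostGraph.∣V∣ G)
  corner G topᶜ   = OutmostGraph.top G
  corner G leftᶜ  = OutmostGraph.left G
  corner G rightᶜ = OutmostGraph.right G

  cornerPattern : (G : OutmostGraph) → Edges (OutmostGraph.∣V∣ G) m → Subset m → Pattern
  cornerPattern G E A = partition λ c d → linked E A (corner G c) (corner G d)

  -- Without edges two vertices are linked only if they are equal.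
  record Proper (G : OutmostGraph) : Set where
    open OutmostGraph G
    field
      corners-distinct : cornerPattern G [] [] ≡ allApart
      connected        : k graph ⊤ ≡ 1

    linked-⊤ : ∀ u v → linked edges ⊤ u v ≡ true
    linked-⊤ u v = dec-true (class u ≟ class v) (all-equal connected (class u) (class v))
      where
      open Quotient (quotient edges ⊤)
      all-equal : ∀ {k} → k ≡ 1 → (i j : Fin k) → i ≡ j
      all-equal refl zero zero = refl

    corners-together : cornerPattern G edges ⊤ ≡ together
    corners-together = cong₂ (λ x z → classify x (linked edges ⊤ top right) z)
      (linked-⊤ top left) (linked-⊤ left right)

    k≢0 : ∀ A → 1 ≤ k graph A
    k≢0 A with k graph A | Quotient.class (quotient edges A) top
    ... | suc _ | _ = s≤s z≤n

    -- The exponent of x - 1 is the number of components less one, because the whole graph is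
    -- connected.
    rank-defect : ∀ A → suc (r graph ⊤ ∸ r graph A) ≡ k graph A
    rank-defect A = begin
      suc (∣V∣ ∸ k graph ⊤ ∸ (∣V∣ ∸ k graph A)) ≡⟨ cong (λ c → suc (∣V∣ ∸ c ∸ (∣V∣ ∸ k graph A))) connected ⟩
      suc (∣V∣ ∸ 1 ∸ (∣V∣ ∸ k graph A))         ≡⟨ cong suc (arith ∣V∣ (k graph A) (k≢0 A) (components≤∣V∣ edges A)) ⟩
      suc (k graph A ∸ 1)                       ≡⟨ m+[n∸m]≡n (k≢0 A) ⟩
      k graph A                                 ∎
      where
      open ≡-Reasoning
      arith : ∀ v c → 1 ≤ c → c ≤ v → v ∸ 1 ∸ (v ∸ c) ≡ c ∸ 1
      arith (suc v) (suc c) _ (s≤s c≤v) = m∸[m∸n]≡n c≤v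

    -- The additive form of the nullity, suited to linear arithmetic over ℕ.
    nullity-def : ∀ A → nullity graph A + ∣V∣ ≡ ∣ A ∣ + k graph A
    nullity-def A = begin
      (∣ A ∣ ∸ (∣V∣ ∸ c)) + ∣V∣            ≡⟨ cong (∣ A ∣ ∸ (∣V∣ ∸ c) +_) (m∸n+n≡m c≤v) ⟨
      (∣ A ∣ ∸ (∣V∣ ∸ c)) + (∣V∣ ∸ c + c)  ≡⟨ +-assoc (∣ A ∣ ∸ (∣V∣ ∸ c)) (∣V∣ ∸ c) c ⟨
      (∣ A ∣ ∸ (∣V∣ ∸ c)) + (∣V∣ ∸ c) + c  ≡⟨ cong (_+ c) (m∸n+n≡m (m≤n+o⇒m∸n≤o ∣V∣ c
                                                (≤-trans (∣V∣≤∣A∣+components edges A) (≤-reflexive (+-comm ∣ A ∣ c))))) ⟩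
      ∣ A ∣ + c                            ∎
      where
      open ≡-Reasoning
      c = k graph A
      c≤v = components≤∣V∣ edges A

  classify-cong : ∀ {x x′ y y′ z z′} → x ≡ x′ → y ≡ y′ → z ≡ z′ → classify x y z ≡ classify x′ y′ z′
  classify-cong refl refl refl = refl

  -- Connectivity, rank and nullity of the glued graph

  module Glued (G : OutmostGraph) (proper : Proper G) where
    open OutmostGraph G
    open Proper proper
    open Gluing G using (glued; class)
    private module G′ = OutmostGraph glued

    module Triple (A₁ A₂ A₃ : Subset ∣E∣) where
      open Copies edges A₁ A₂ A₃ (corner G) public using (A)
      private
        module Cp = Copies edges A₁ A₂ A₃ (corner G)
        p₁ = cornerPattern G edges A₁
        p₂ = cornerPattern G edges A₂
        p₃ = cornerPattern G edges A₃
        module K = Contraction Cp.identified Cp.copies A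

      isClosed : Bool
      isClosed = closed p₁ p₂ p₃

      -- `linked-contract` turns the contracted identifications into additional edges, where
      -- `linked-glued` applies.
      linked-site : ∀ s t → linked G′.edges A (class (Cp.site s)) (class (Cp.site t))
                            ≡ glue₃ (blocks p₁ p₂ p₃) s t
      linked-site s t = trans (K.linked-contract (Cp.site s) (Cp.site t)) (Cp.linked-glued s t)

      cornerPattern-glued : cornerPattern glued G′.edges A ≡ glue p₁ p₂ p₃
      cornerPattern-glued = classify-cong
        (linked-site (outmost topᶜ) (outmost leftᶜ))
        (linked-site (outmost topᶜ) (outmost rightᶜ))
        (linked-site (outmost leftᶜ) (outmost rightᶜ))

      k-glued : k G′.graph A + (if isClosed then 0 else 1) + 1 + 1
                ≡ k graph A₁ + (k graph A₂ + k graph A₃)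
      k-glued = trans (cong (λ c → c + (if isClosed then 0 else 1) + 1 + 1) K.components-contract)
        Cp.components-glued

    private
      module Discrete = Copies {n = ∣V∣} [] [] [] [] (corner G)

    -- The vertices of the glued graph are the components of three edgeless copies with the
    -- identifications added. Distinct corners leave the cycle open, so all three identifications
    -- merge.
    ∣V∣-glued : G′.∣V∣ + 3 ≡ ∣V∣ + (∣V∣ + ∣V∣)
    ∣V∣-glued = begin
      G′.∣V∣ + 3             ≡⟨ solve 1 (λ v → v :+ con 3 := v :+ con 1 :+ con 1 :+ con 1) refl G′.∣V∣ ⟩
      G′.∣V∣ + 1 + 1 + 1     ≡⟨ cong (λ p → G′.∣V∣ + (if closed p p p then 0 else 1) + 1 + 1) corners-distinct ⟨
      G′.∣V∣ + (if closed p p p then 0 else 1) + 1 + 1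
                             ≡⟨ Discrete.components-glued ⟩
      ∣V∣ + (∣V∣ + ∣V∣)      ∎
      where
      open ≡-Reasoning
      open +-*-Solver
      p = cornerPattern G [] []

    proper-glued : Proper glued
    proper-glued = record
      { corners-distinct = trans distinct (cong (λ p → glue p p p) corners-distinct)
      ; connected = trans (cong (k G′.graph) ⊤-glued) (suc-injective (suc-injective (trans (+-comm 2 _) k⊤)))
      }
      where
      distinct : cornerPattern glued [] [] ≡
        glue (cornerPattern G [] []) (cornerPattern G [] []) (cornerPattern G [] [])
      distinct = classify-cong
        (Discrete.linked-glued (outmost topᶜ) (outmost leftᶜ))
        (Discrete.linked-glued (outmost topᶜ) (outmost rightᶜ))
        (Discrete.linked-glued (outmost leftᶜ) (outmost rightᶜ))

      open Triple ⊤ ⊤ ⊤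

      ⊤-glued : ⊤ {G′.∣E∣} ≡ A
      ⊤-glued = trans (⊤-++ ∣E∣ {∣E∣ + (∣E∣ + 0)}) (cong (⊤ {∣E∣} ++_)
        (trans (⊤-++ ∣E∣ {∣E∣ + 0}) (cong (⊤ {∣E∣} ++_) (⊤-++ ∣E∣ {0}))))

      k⊤ : k G′.graph A + 2 ≡ 3
      k⊤ = begin
        k G′.graph A + 2         ≡⟨ solve 1 (λ x → x :+ con 2 := x :+ con 0 :+ con 1 :+ con 1) refl (k G′.graph A) ⟩
        -- Three connected copies close the cycle, so only two of the identifications merge
        -- components.
        k G′.graph A + 0 + 1 + 1 ≡⟨ cong (λ p → k G′.graph A + (if closed p p p then 0 else 1) + 1 + 1) corners-together ⟨
        k G′.graph A + (if isClosed then 0 else 1) + 1 + 1 ≡⟨ k-glued ⟩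
        k graph ⊤ + (k graph ⊤ + k graph ⊤) ≡⟨ cong (λ c → c + (c + c)) connected ⟩
        3 ∎
        where
        open ≡-Reasoning
        open +-*-Solver

    module _ (A₁ A₂ A₃ : Subset ∣E∣) where
      open Triple A₁ A₂ A₃
      private
        defect : Subset ∣E∣ → ℕ
        defect B = r graph ⊤ ∸ r graph B

        open-cycle : ℕ
        open-cycle = if isClosed then 0 else 1

      -- The defect is one less than the number of components. Three copies lose three such units,
      -- the glued graph one, and the two merges that always occur account for the difference.
      defect-glued : (r G′.graph ⊤ ∸ r G′.graph A) + open-cycle ≡ defect A₁ + defect A₂ + defect A₃
      defect-glued = +-cancelˡ-≡ 3 _ _ (begin
        3 + (defect′ + open-cycle)  ≡⟨ solve 2 (λ x y → con 3 :+ (x :+ y) := (con 1 :+ x) :+ y :+ con 1 :+ con 1) refl defect′ open-cycle ⟩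
        suc defect′ + open-cycle + 1 + 1 ≡⟨ cong (λ c → c + open-cycle + 1 + 1) (Proper.rank-defect proper-glued A) ⟩
        k G′.graph A + open-cycle + 1 + 1 ≡⟨ k-glued ⟩
        k graph A₁ + (k graph A₂ + k graph A₃)
          ≡⟨ cong₂ _+_ (rank-defect A₁) (cong₂ _+_ (rank-defect A₂) (rank-defect A₃)) ⟨
        suc (defect A₁) + (suc (defect A₂) + suc (defect A₃))
          ≡⟨ solve 3 (λ x y z → con 1 :+ x :+ (con 1 :+ y :+ (con 1 :+ z)) := con 3 :+ (x :+ y :+ z)) refl (defect A₁) (defect A₂) (defect A₃) ⟩
        3 + (defect A₁ + defect A₂ + defect A₃) ∎)
        where
        open ≡-Reasoning
        open +-*-Solver
        defect′ = r G′.graph ⊤ ∸ r G′.graph A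

      -- The nullity is |A| + k(A) - |V|, whose terms all add up over the copies except for the
      -- merges and the three lost vertices. A closed cycle thus raises the nullity by one.
      nullity-glued : nullity G′.graph A + open-cycle
                      ≡ nullity graph A₁ + nullity graph A₂ + nullity graph A₃ + 1
      nullity-glued = arith (nullity G′.graph A) open-cycle G′.∣V∣ ∣V∣ ∣ A ∣ (k G′.graph A)
        (∣ A₁ ∣) (∣ A₂ ∣) (∣ A₃ ∣) (k graph A₁) (k graph A₂) (k graph A₃)
        (Proper.nullity-def proper-glued A) ∣V∣-glued
        (trans (∣++∣ A₁ (A₂ ++ (A₃ ++ []))) (cong (∣ A₁ ∣ +_)
          (trans (∣++∣ A₂ (A₃ ++ [])) (cong (∣ A₂ ∣ +_) (trans (∣++∣ A₃ []) (+-identityʳ _))))))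
        k-glued (nullity-def A₁) (nullity-def A₂) (nullity-def A₃)
        where
        open ≡-Reasoning
        open +-*-Solver
        arith : ∀ n′ d v′ v a′ c′ a₁ a₂ a₃ c₁ c₂ c₃ {n₁ n₂ n₃} →
                n′ + v′ ≡ a′ + c′ → v′ + 3 ≡ v + (v + v) → a′ ≡ a₁ + (a₂ + a₃) →
                c′ + d + 1 + 1 ≡ c₁ + (c₂ + c₃) →
                n₁ + v ≡ a₁ + c₁ → n₂ + v ≡ a₂ + c₂ → n₃ + v ≡ a₃ + c₃ →
                n′ + d ≡ n₁ + n₂ + n₃ + 1
        arith n′ d v′ v a′ c′ a₁ a₂ a₃ c₁ c₂ c₃ {n₁} {n₂} {n₃} e ev ea ec e₁ e₂ e₃ =
          -- Adding 3|V| gives each nullity the vertex count with which `nullity-def` pairs it.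
          +-cancelˡ-≡ (v + (v + v)) _ _ (begin
            v + (v + v) + (n′ + d)   ≡⟨ cong (_+ (n′ + d)) ev ⟨
            v′ + 3 + (n′ + d)        ≡⟨ solve 3 (λ v′ n′ d → v′ :+ con 3 :+ (n′ :+ d) := n′ :+ v′ :+ d :+ con 3) refl v′ n′ d ⟩
            n′ + v′ + d + 3          ≡⟨ cong (λ x → x + d + 3) e ⟩
            a′ + c′ + d + 3          ≡⟨ solve 3 (λ a′ c′ d → a′ :+ c′ :+ d :+ con 3 := a′ :+ (c′ :+ d :+ con 1 :+ con 1) :+ con 1) refl a′ c′ d ⟩
            a′ + (c′ + d + 1 + 1) + 1 ≡⟨ cong₂ (λ x y → x + y + 1) ea ec ⟩
            a₁ + (a₂ + a₃) + (c₁ + (c₂ + c₃)) + 1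
              ≡⟨ solve 6 (λ a₁ a₂ a₃ c₁ c₂ c₃ → a₁ :+ (a₂ :+ a₃) :+ (c₁ :+ (c₂ :+ c₃)) :+ con 1
                   := (a₁ :+ c₁) :+ ((a₂ :+ c₂) :+ (a₃ :+ c₃)) :+ con 1) refl a₁ a₂ a₃ c₁ c₂ c₃ ⟩
            (a₁ + c₁) + ((a₂ + c₂) + (a₃ + c₃)) + 1
              ≡⟨ cong (_+ 1) (cong₂ _+_ e₁ (cong₂ _+_ e₂ e₃)) ⟨
            (n₁ + v) + ((n₂ + v) + (n₃ + v)) + 1
              ≡⟨ solve 4 (λ n₁ n₂ n₃ v → (n₁ :+ v) :+ ((n₂ :+ v) :+ (n₃ :+ v)) :+ con 1
                   := v :+ (v :+ v) :+ (n₁ :+ n₂ :+ n₃ :+ con 1)) refl n₁ n₂ n₃ v ⟩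
            v + (v + v) + (n₁ + n₂ + n₃ + 1) ∎)

open Combinatorics

-- Finite sums over subsets, sorted by pattern

infix 4 _==_
_==_ : Pattern → Pattern → Bool
together     == together     = true
allApart     == allApart     = true
apart topᶜ   == apart topᶜ   = true
apart leftᶜ  == apart leftᶜ  = true
apart rightᶜ == apart rightᶜ = true
_            == _            = false

patterns : List Pattern
patterns = together ∷ apart topᶜ ∷ apart leftᶜ ∷ apart rightᶜ ∷ allApart ∷ []

module Sums {c ℓ} (R : CommutativeRing c ℓ) where
  open CommutativeRing R
  open SetoidReasoning setoid
  open CommutativeSemigroupProperties +-commutativeSemigroup using (interchange)

  -- Stated over any commutative ring, as it is needed both over ℤ[x,y] and over ℚ(x,y). Over ℤ[x,y]
  -- it agrees definitionally with the sum that defines the Tutte polynomial.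
  ∑ : {B : Set} → List B → (B → Carrier) → Carrier
  ∑ as f = List.foldr _+_ 0# (List.map f as)

  [_] : Bool → Carrier
  [ b ] = if b then 1# else 0#

  private
    variable
      B B′ : Set

  ∑-cong : ∀ (as : List B) {f g} → (∀ a → f a ≈ g a) → ∑ as f ≈ ∑ as g
  ∑-cong []       f≈g = refl
  ∑-cong (a ∷ as) f≈g = +-cong (f≈g a) (∑-cong as f≈g)

  ∑-++ : ∀ (as bs : List B) f → ∑ (as List.++ bs) f ≈ ∑ as f + ∑ bs f
  ∑-++ []       bs f = sym (+-identityˡ _)
  ∑-++ (a ∷ as) bs f = trans (+-congˡ (∑-++ as bs f)) (sym (+-assoc _ _ _))

  ∑-map : ∀ (h : B′ → B) as f → ∑ (List.map h as) f ≈ ∑ as (f ∘ h)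
  ∑-map h []       f = refl
  ∑-map h (a ∷ as) f = +-congˡ (∑-map h as f)

  ∑-+ : ∀ (as : List B) f g → ∑ as (λ a → f a + g a) ≈ ∑ as f + ∑ as g
  ∑-+ []       f g = sym (+-identityˡ 0#)
  ∑-+ (a ∷ as) f g = trans (+-congˡ (∑-+ as f g)) (interchange _ _ _ _)

  *-∑ : ∀ a (as : List B) f → a * ∑ as f ≈ ∑ as (λ b → a * f b)
  *-∑ a []       f = zeroʳ a
  *-∑ a (b ∷ as) f = trans (distribˡ _ _ _) (+-congˡ (*-∑ a as f))

  ∑-* : ∀ (as : List B) f a → ∑ as f * a ≈ ∑ as (λ b → f b * a)
  ∑-* []       f a = zeroˡ a
  ∑-* (b ∷ as) f a = trans (distribʳ _ _ _) (+-congˡ (∑-* as f a))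

  ∑-filter : ∀ {P : Pred B 0ℓ} (P? : Decidable P) as f →
             ∑ (List.filter P? as) f ≈ ∑ as (λ a → [ does (P? a) ] * f a)
  ∑-filter P? []       f = refl
  ∑-filter P? (a ∷ as) f with does (P? a)
  ... | true  = +-cong (sym (*-identityˡ _)) (∑-filter P? as f)
  ... | false = trans (∑-filter P? as f) (sym (trans (+-congʳ (zeroˡ _)) (+-identityˡ _)))

  ∑-zero : ∀ (as : List B) → ∑ as (λ _ → 0#) ≈ 0#
  ∑-zero []       = refl
  ∑-zero (a ∷ as) = trans (+-identityˡ _) (∑-zero as)

  ∑-swap : (as : List B) (bs : List B′) (f : B → B′ → Carrier) →
           ∑ as (λ a → ∑ bs (f a)) ≈ ∑ bs (λ b → ∑ as (λ a → f a b))
  ∑-swap []       bs f = sym (∑-zero bs)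
  ∑-swap (a ∷ as) bs f = trans (+-congˡ (∑-swap as bs f)) (sym (∑-+ bs (f a) _))

  ∑-subsets-++ : ∀ m {n} (f : Subset (m Nat.+ n) → Carrier) →
                 ∑ (subsets (m Nat.+ n)) f ≈ ∑ (subsets m) λ A → ∑ (subsets n) λ B → f (A ++ B)
  ∑-subsets-++ zero        f = sym (+-identityʳ _)
  ∑-subsets-++ (suc m) {n} f = begin
    ∑ (subsets (suc m Nat.+ n)) f
      ≈⟨ ∑-++ (List.map (outside ∷_) (subsets (m Nat.+ n))) _ f ⟩
    ∑ (List.map (outside ∷_) (subsets (m Nat.+ n))) f + ∑ (List.map (inside ∷_) (subsets (m Nat.+ n))) f
      ≈⟨ +-cong (half outside) (half inside) ⟩
    ∑ (List.map (outside ∷_) (subsets m)) g + ∑ (List.map (inside ∷_) (subsets m)) g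
      ≈⟨ ∑-++ (List.map (outside ∷_) (subsets m)) _ g ⟨
    ∑ (subsets (suc m)) g ∎
    where
    g : Subset (suc m) → Carrier
    g A = ∑ (subsets n) λ B → f (A ++ B)

    half : ∀ s → ∑ (List.map (s ∷_) (subsets (m Nat.+ n))) f ≈ ∑ (List.map (s ∷_) (subsets m)) g
    half s = trans (∑-map (s ∷_) (subsets (m Nat.+ n)) f)
      (trans (∑-subsets-++ m (f ∘ (s ∷_))) (sym (∑-map (s ∷_) (subsets m) g)))

  ∑-subsets-3* : ∀ m (f : Subset (3 Nat.* m) → Carrier) → ∑ (subsets (3 Nat.* m)) f ≈
    ∑ (subsets m) λ A₁ → ∑ (subsets m) λ A₂ → ∑ (subsets m) λ A₃ → f (A₁ ++ (A₂ ++ (A₃ ++ [])))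
  ∑-subsets-3* m f = trans (∑-subsets-++ m f) (∑-cong (subsets m) λ A₁ →
    trans (∑-subsets-++ m (λ A → f (A₁ ++ A))) (∑-cong (subsets m) λ A₂ →
    trans (∑-subsets-++ m (λ A → f (A₁ ++ (A₂ ++ A)))) (∑-cong (subsets m) λ A₃ →
    +-identityʳ _)))

  module _ {B : Set} (as : List B) (pat : B → Pattern) (w : B → Carrier) where

    ∑-of : Pattern → Carrier
    ∑-of q = ∑ as λ a → [ q == pat a ] * w a

    private
      open SemiringSolver commutativeSemiring using (Polynomial; solve; con; _:*_; _:+_; _:=_)

      -- The numerals are the values of the indicator along `patterns`; exactly one of them is 1.
      row : (i j k l m : ℕ) → (a b c d e u : Polynomial 6) → Polynomial 6
      row i j k l m a b c d e u = a :* (con i :* u) :+ (b :* (con j :* u) :+ (c :* (con k :* u)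
        :+ (d :* (con l :* u) :+ (e :* (con m :* u) :+ con 0))))

      split : ∀ (g : Pattern → Carrier) p u → g p * u ≈ ∑ patterns λ q → g q * ([ q == p ] * u)
      split g together u = solve 6 (λ a b c d e u → a :* u := row 1 0 0 0 0 a b c d e u) refl
        (g together) (g (apart topᶜ)) (g (apart leftᶜ)) (g (apart rightᶜ)) (g allApart) u
      split g (apart topᶜ) u = solve 6 (λ a b c d e u → b :* u := row 0 1 0 0 0 a b c d e u) refl
        (g together) (g (apart topᶜ)) (g (apart leftᶜ)) (g (apart rightᶜ)) (g allApart) u
      split g (apart leftᶜ) u = solve 6 (λ a b c d e u → c :* u := row 0 0 1 0 0 a b c d e u) refl
        (g together) (g (apart topᶜ)) (g (apart leftᶜ)) (g (apart rightᶜ)) (g allApart) u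
      split g (apart rightᶜ) u = solve 6 (λ a b c d e u → d :* u := row 0 0 0 1 0 a b c d e u) refl
        (g together) (g (apart topᶜ)) (g (apart leftᶜ)) (g (apart rightᶜ)) (g allApart) u
      split g allApart u = solve 6 (λ a b c d e u → e :* u := row 0 0 0 0 1 a b c d e u) refl
        (g together) (g (apart topᶜ)) (g (apart leftᶜ)) (g (apart rightᶜ)) (g allApart) u

    -- Each summand is spread over all patterns by an indicator, and the two sums are exchanged.
    ∑-by-pattern : (g : Pattern → Carrier) →
                   ∑ as (λ a → g (pat a) * w a) ≈ ∑ patterns λ q → g q * ∑-of q
    ∑-by-pattern g = begin
      ∑ as (λ a → g (pat a) * w a)        ≈⟨ ∑-cong as (λ a → split g (pat a) (w a)) ⟩
      ∑ as (λ a → ∑ patterns (f a))       ≈⟨ ∑-swap as patterns f ⟩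
      ∑ patterns (λ q → ∑ as λ a → f a q)
        ≈⟨ ∑-cong patterns {λ q → g q * ∑-of q} (λ q → *-∑ (g q) as λ a → [ q == pat a ] * w a) ⟨
      ∑ patterns (λ q → g q * ∑-of q)     ∎
      where
      f : B → Pattern → Carrier
      f a q = g q * ([ q == pat a ] * w a)

    module _ (s : Pattern → Carrier) (∑≈s : ∀ q → ∑-of q ≈ s q) where

      ∑-linear : (g : Pattern → Carrier) →
                 ∑ as (λ a → g (pat a) * w a) ≈ ∑ patterns λ q → g q * s q
      ∑-linear g = trans (∑-by-pattern g)
        (∑-cong patterns {λ q → g q * ∑-of q} {λ q → g q * s q} λ q → *-congˡ (∑≈s q))

      -- `∑-linear` is applied once for each copy, innermost first. The weights stand in the order
      -- `a₃`, `a₂`, `a₁`, so that the outer ones factor out of the inner sums on the right.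
      ∑-trilinear : (g : Pattern → Pattern → Pattern → Carrier) →
        ∑ as (λ a₁ → ∑ as λ a₂ → ∑ as λ a₃ → g (pat a₁) (pat a₂) (pat a₃) * w a₃ * w a₂ * w a₁)
        ≈ ∑ patterns λ p₁ → (∑ patterns λ p₂ → (∑ patterns λ p₃ → g p₁ p₂ p₃ * s p₃) * s p₂) * s p₁
      ∑-trilinear g = begin
        ∑ as (λ a₁ → ∑ as λ a₂ → ∑ as λ a₃ → g (pat a₁) (pat a₂) (pat a₃) * w a₃ * w a₂ * w a₁)
          ≈⟨ ∑-cong as (λ a₁ → ∑-cong as λ a₂ →
               trans (*-congʳ (∑-* as (λ a₃ → g (pat a₁) (pat a₂) (pat a₃) * w a₃) (w a₂)))
                     (∑-* as (λ a₃ → g (pat a₁) (pat a₂) (pat a₃) * w a₃ * w a₂) (w a₁))) ⟨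
        ∑ as (λ a₁ → ∑ as λ a₂ → ∑ as (λ a₃ → g (pat a₁) (pat a₂) (pat a₃) * w a₃) * w a₂ * w a₁)
          ≈⟨ ∑-cong as (λ a₁ → ∑-cong as λ a₂ →
               *-congʳ (*-congʳ (∑-linear (g (pat a₁) (pat a₂))))) ⟩
        ∑ as (λ a₁ → ∑ as λ a₂ → g₂ (pat a₁) (pat a₂) * w a₂ * w a₁)
          ≈⟨ ∑-cong as (λ a₁ → ∑-* as (λ a₂ → g₂ (pat a₁) (pat a₂) * w a₂) (w a₁)) ⟨
        ∑ as (λ a₁ → ∑ as (λ a₂ → g₂ (pat a₁) (pat a₂) * w a₂) * w a₁)
          ≈⟨ ∑-cong as (λ a₁ → *-congʳ (∑-linear (g₂ (pat a₁)))) ⟩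
        ∑ as (λ a₁ → g₁ (pat a₁) * w a₁)
          ≈⟨ ∑-linear g₁ ⟩
        ∑ patterns (λ p₁ → g₁ p₁ * s p₁) ∎
        where
        g₂ : Pattern → Pattern → Carrier
        g₂ p₁ p₂ = ∑ patterns λ p₃ → g p₁ p₂ p₃ * s p₃
        g₁ : Pattern → Carrier
        g₁ p₁ = ∑ patterns λ p₂ → g₂ p₁ p₂ * s p₂

-- Weights of glued subgraphs

patternOf : (G : OutmostGraph) → Subset (OutmostGraph.∣E∣ G) → Pattern
patternOf G = cornerPattern G (OutmostGraph.edges G)

module Weighted {c ℓ} (R : CommutativeRing c ℓ) (x y : CommutativeRing.Carrier R) where
  open CommutativeRing R
  open RawSemiringDefinitions (Semiring.rawSemiring semiring) using (_^_)
  open Exp semiring using (^-homo-*)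
  open SetoidReasoning setoid
  open Sums R
  open SemiringSolver commutativeSemiring using (solve; con; _:*_; _:+_; _:=_)

  private
    X Y : Carrier
    X = x - 1#
    Y = y - 1#

  weight : (G : Graph) → SpanningSubgraph G → Carrier
  weight G A = (x - 1#) ^ (r G ⊤ ∸ r G A) * (y - 1#) ^ nullity G A

  module _ (G : OutmostGraph) where
    open OutmostGraph G

    S : Pattern → Carrier
    S = ∑-of (subsets ∣E∣) (patternOf G) (weight graph)

    S≈∑-filter : ∀ q {P : Pred (SpanningSubgraph graph) 0ℓ} (P? : Decidable P) →
                 (∀ A → (q == patternOf G A) ≡ does (P? A)) →
                 S q ≈ ∑ (List.filter P? (subsets ∣E∣)) (weight graph)
    S≈∑-filter q P? q≡P = trans
      (∑-cong (subsets ∣E∣) λ A → *-congʳ (reflexive (cong [_] (q≡P A))))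
      (sym (∑-filter P? (subsets ∣E∣) (weight graph)))

  -- The factor Y or 1/X by which gluing changes the product of the weights, multiplied by X to
  -- remain in the ring.
  factor : Bool → Carrier
  factor closed = if closed then X * Y else 1#

  module _ (G : OutmostGraph) (proper : Proper G) where
    open OutmostGraph G
    open Gluing G using (glued)
    private module G′ = OutmostGraph glued
    open Glued G proper

    -- A closed cycle keeps the exponent of X and raises that of Y by one. An open one keeps the
    -- exponent of Y and lowers that of X by one, which the extra X on the left restores.
    weight-glued : ∀ A₁ A₂ A₃ → X * weight G′.graph (Triple.A A₁ A₂ A₃) ≈
      factor (Triple.isClosed A₁ A₂ A₃) * weight graph A₃ * weight graph A₂ * weight graph A₁
    weight-glued A₁ A₂ A₃ = exponents (Triple.isClosed A₁ A₂ A₃)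
      (r G′.graph ⊤ ∸ r G′.graph (Triple.A A₁ A₂ A₃)) (nullity G′.graph (Triple.A A₁ A₂ A₃))
      (κ A₁) (κ A₂) (κ A₃) (nullity graph A₁) (nullity graph A₂) (nullity graph A₃)
      (defect-glued A₁ A₂ A₃) (nullity-glued A₁ A₂ A₃)
      where
      κ : Subset ∣E∣ → ℕ
      κ A = r graph ⊤ ∸ r graph A

      expand : ∀ a b c d e f → X ^ (a Nat.+ b Nat.+ c) * Y ^ (d Nat.+ e Nat.+ f)
               ≈ X ^ c * Y ^ f * (X ^ b * Y ^ e) * (X ^ a * Y ^ d)
      expand a b c d e f = begin
        X ^ (a Nat.+ b Nat.+ c) * Y ^ (d Nat.+ e Nat.+ f)
          ≈⟨ *-cong (trans (^-homo-* X (a Nat.+ b) c) (*-congʳ (^-homo-* X a b)))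
                    (trans (^-homo-* Y (d Nat.+ e) f) (*-congʳ (^-homo-* Y d e))) ⟩
        X ^ a * X ^ b * X ^ c * (Y ^ d * Y ^ e * Y ^ f)
          ≈⟨ solve 6 (λ a b c d e f → a :* b :* c :* (d :* e :* f) := c :* f :* (b :* e) :* (a :* d))
               refl (X ^ a) (X ^ b) (X ^ c) (Y ^ d) (Y ^ e) (Y ^ f) ⟩
        X ^ c * Y ^ f * (X ^ b * Y ^ e) * (X ^ a * Y ^ d) ∎

      exponents : ∀ b κ ν κ₁ κ₂ κ₃ ν₁ ν₂ ν₃ →
        κ Nat.+ (if b then 0 else 1) ≡ κ₁ Nat.+ κ₂ Nat.+ κ₃ →
        ν Nat.+ (if b then 0 else 1) ≡ ν₁ Nat.+ ν₂ Nat.+ ν₃ Nat.+ 1 →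
        X * (X ^ κ * Y ^ ν) ≈
        factor b * (X ^ κ₃ * Y ^ ν₃) * (X ^ κ₂ * Y ^ ν₂) * (X ^ κ₁ * Y ^ ν₁)
      exponents true κ ν κ₁ κ₂ κ₃ ν₁ ν₂ ν₃ eκ eν
        rewrite ≡.trans (≡.sym (ℕₚ.+-identityʳ κ)) eκ
              | ≡.trans (≡.sym (ℕₚ.+-identityʳ ν)) (≡.trans eν (ℕₚ.+-comm _ 1)) = begin
        X * (X ^ (κ₁ Nat.+ κ₂ Nat.+ κ₃) * (Y * Y ^ (ν₁ Nat.+ ν₂ Nat.+ ν₃)))
          ≈⟨ solve 4 (λ X Y u v → X :* (u :* (Y :* v)) := X :* Y :* (u :* v)) refl X Y _ _ ⟩
        X * Y * (X ^ (κ₁ Nat.+ κ₂ Nat.+ κ₃) * Y ^ (ν₁ Nat.+ ν₂ Nat.+ ν₃))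
          ≈⟨ *-congˡ (expand κ₁ κ₂ κ₃ ν₁ ν₂ ν₃) ⟩
        X * Y * (X ^ κ₃ * Y ^ ν₃ * (X ^ κ₂ * Y ^ ν₂) * (X ^ κ₁ * Y ^ ν₁))
          ≈⟨ solve 4 (λ c u v w → c :* (u :* v :* w) := c :* u :* v :* w) refl (X * Y) _ _ _ ⟩
        X * Y * (X ^ κ₃ * Y ^ ν₃) * (X ^ κ₂ * Y ^ ν₂) * (X ^ κ₁ * Y ^ ν₁) ∎
      exponents false κ ν κ₁ κ₂ κ₃ ν₁ ν₂ ν₃ eκ eν = begin
        X * (X ^ κ * Y ^ ν)
          ≈⟨ *-assoc _ _ _ ⟨
        X ^ suc κ * Y ^ ν
          ≡⟨ cong₂ (λ a b → X ^ a * Y ^ b) (≡.trans (ℕₚ.+-comm 1 κ) eκ) (ℕₚ.+-cancelʳ-≡ 1 _ _ eν) ⟩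
        X ^ (κ₁ Nat.+ κ₂ Nat.+ κ₃) * Y ^ (ν₁ Nat.+ ν₂ Nat.+ ν₃)
          ≈⟨ expand κ₁ κ₂ κ₃ ν₁ ν₂ ν₃ ⟩
        X ^ κ₃ * Y ^ ν₃ * (X ^ κ₂ * Y ^ ν₂) * (X ^ κ₁ * Y ^ ν₁)
          ≈⟨ *-congʳ (*-congʳ (*-identityˡ _)) ⟨
        1# * (X ^ κ₃ * Y ^ ν₃) * (X ^ κ₂ * Y ^ ν₂) * (X ^ κ₁ * Y ^ ν₁) ∎

    coefficient : Pattern → Pattern → Pattern → Pattern → Carrier
    coefficient q p₁ p₂ p₃ = [ q == glue p₁ p₂ p₃ ] * factor (closed p₁ p₂ p₃)

    -- The coefficient of a triple depends on its patterns only, so the sum over all triples is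
    -- trilinear in the sums by pattern. The parameter `s` allows equal sums to become one variable
    -- later.
    S-glued : ∀ (s : Pattern → Carrier) → (∀ q → S G q ≈ s q) → ∀ q → X * S glued q ≈
      ∑ patterns λ p₁ → (∑ patterns λ p₂ → (∑ patterns λ p₃ →
        coefficient q p₁ p₂ p₃ * s p₃) * s p₂) * s p₁
    S-glued s S≈s q = begin
      X * S glued q
        ≈⟨ *-∑ X (subsets G′.∣E∣) _ ⟩
      ∑ (subsets G′.∣E∣) (λ A → X * ([ q == patternOf glued A ] * weight G′.graph A))
        ≈⟨ ∑-subsets-3* ∣E∣ _ ⟩
      ∑ (subsets ∣E∣) (λ A₁ → ∑ (subsets ∣E∣) λ A₂ → ∑ (subsets ∣E∣) λ A₃ →
        X * ([ q == patternOf glued (Triple.A A₁ A₂ A₃) ] * weight G′.graph (Triple.A A₁ A₂ A₃)))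
        ≈⟨ ∑-cong (subsets ∣E∣) (λ A₁ → ∑-cong (subsets ∣E∣) λ A₂ → ∑-cong (subsets ∣E∣) λ A₃ → term A₁ A₂ A₃) ⟩
      ∑ (subsets ∣E∣) (λ A₁ → ∑ (subsets ∣E∣) λ A₂ → ∑ (subsets ∣E∣) λ A₃ →
        coefficient q (patternOf G A₁) (patternOf G A₂) (patternOf G A₃)
          * weight graph A₃ * weight graph A₂ * weight graph A₁)
        ≈⟨ ∑-trilinear (subsets ∣E∣) (patternOf G) (weight graph) s S≈s (coefficient q) ⟩
      _ ∎
      where
      term : ∀ A₁ A₂ A₃ →
        X * ([ q == patternOf glued (Triple.A A₁ A₂ A₃) ] * weight G′.graph (Triple.A A₁ A₂ A₃)) ≈
        coefficient q (patternOf G A₁) (patternOf G A₂) (patternOf G A₃)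
          * weight graph A₃ * weight graph A₂ * weight graph A₁
      term A₁ A₂ A₃ = begin
        X * ([ q == patternOf glued (Triple.A A₁ A₂ A₃) ] * w)
          ≡⟨ cong (λ p → X * ([ q == p ] * w)) (Triple.cornerPattern-glued A₁ A₂ A₃) ⟩
        X * (b * w)
          ≈⟨ solve 3 (λ X b w → X :* (b :* w) := b :* (X :* w)) refl X b w ⟩
        b * (X * w)
          ≈⟨ *-congˡ (weight-glued A₁ A₂ A₃) ⟩
        b * (f * w₃ * w₂ * w₁)
          ≈⟨ solve 5 (λ b f u v w → b :* (f :* u :* v :* w) := b :* f :* u :* v :* w) refl b f w₃ w₂ w₁ ⟩
        b * f * w₃ * w₂ * w₁ ∎
        where
        w w₁ w₂ w₃ b f : Carrier
        w = weight G′.graph (Triple.A A₁ A₂ A₃)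
        w₁ = weight graph A₁
        w₂ = weight graph A₂
        w₃ = weight graph A₃
        b = [ q == glue (patternOf G A₁) (patternOf G A₂) (patternOf G A₃) ]
        f = factor (Triple.isClosed A₁ A₂ A₃)

-- The recurrences and the initial values

proper-triangle : Proper triangle
proper-triangle = record { corners-distinct = ≡.refl ; connected = ≡.refl }

proper-Γ : ∀ n .{{_ : NonZero n}} → Proper (Γ n)
proper-Γ (suc zero)      = proper-triangle
proper-Γ (suc n@(suc _)) = Glued.proper-glued (Γ n) (proper-Γ n)

-- The operations are parameters so that over ℚ(x,y) the equations come out
-- syntactically as in the theorem: comparing them up to unfolding is infeasible.
record Recurrence {c ℓ} {C : Set c} (_≋_ : C → C → Set ℓ) (_⊞_ _⊠_ _⊟_ : C → C → C)
                  (power : C → ℕ → C) (multiple : ℕ → C → C)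
                  (1# y i t₂ t₁ t₀ t₂′ t₁′ t₀′ : C) : Set ℓ where
  field
    equations :
      let infix 4 _≈_
          infixl 6 _+_ _-_
          infixl 7 _*_
          infixr 8 _^_ _·_
          _≈_ = _≋_
          _+_ = _⊞_
          _-_ = _⊟_
          _*_ = _⊠_
          _^_ = power
          _·_ = multiple
      in
      (t₂′ ≈
        (y - 1#) * t₂ ^ 3
        + i * (6 · t₂ ^ 2 * t₁ + 3 · t₂ * t₁ ^ 2))
      ×
      (t₁′ ≈
        (y - 1#) * t₂ ^ 2 * t₁
        + i * (t₂ ^ 2 * t₀ + 7 · t₂ * t₁ ^ 2 + 2 · t₂ * t₁ * t₀
               + 4 · t₁ ^ 3 + t₁ ^ 2 * t₀))
      ×
      (t₀′ ≈
        (y - 1#) * (3 · t₂ * t₁ ^ 2 + t₁ ^ 3)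
        + i * (12 · t₂ * t₁ * t₀ + 3 · t₂ * t₀ ^ 2 + 14 · t₁ ^ 3
               + 24 · t₁ ^ 2 * t₀ + 9 · t₁ * t₀ ^ 2 + t₀ ^ 3))

module Recursion {c ℓ} (R : CommutativeRing c ℓ) (x y : CommutativeRing.Carrier R) where
  open CommutativeRing R
  open RawSemiringDefinitions (Semiring.rawSemiring semiring) using (_^_) renaming (_×_ to _·_)
  open SetoidReasoning setoid
  open Sums R
  open Weighted R x y
  open SemiringSolver commutativeSemiring using (Polynomial; solve; con; _:*_; _:+_; _:=_)

  private
    X Y : Carrier
    X = x - 1#
    Y = y - 1#

    infixr 9 _:^_ _:·_
    -- This and `_:·_` unfold as `_^_` and `_·_` do, so that the solved identities are about those
    -- operations.
    _:^_ : ∀ {n} → Polynomial n → ℕ → Polynomial n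
    p :^ zero  = con 1
    p :^ suc n = p :* p :^ n

    _:·_ : ∀ {n} → ℕ → Polynomial n → Polynomial n
    zero  :· p = con 0
    suc n :· p = p :+ n :· p

    :∑ : ∀ {n} → (Pattern → Polynomial n) → Polynomial n
    :∑ f = List.foldr _:+_ (con 0) (List.map f patterns)

    module _ {n} (X Y t₂ t₁ t₀ : Polynomial n) where
      :s : Pattern → Polynomial n
      :s together  = t₂
      :s (apart _) = t₁
      :s allApart  = t₀

      -- Evaluates definitionally to the sum in `S-glued`.
      :glued : Pattern → Polynomial n
      :glued q = :∑ λ p₁ → (:∑ λ p₂ → (:∑ λ p₃ →
        (if q == glue p₁ p₂ p₃ then con 1 else con 0) :* (if closed p₁ p₂ p₃ then X :* Y else con 1)
        :* :s p₃) :* :s p₂) :* :s p₁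

      :apart-glued : Polynomial n
      :apart-glued = X :* (Y :* t₂ :^ 2 :* t₁)
        :+ (t₂ :^ 2 :* t₀ :+ 7 :· t₂ :* t₁ :^ 2 :+ 2 :· t₂ :* t₁ :* t₀
            :+ 4 :· t₁ :^ 3 :+ t₁ :^ 2 :* t₀)

  divide : ∀ {i} → X * i ≈ 1# → ∀ {a b d} → X * a ≈ X * b + d → a ≈ b + i * d
  divide {i} Xi≈1 {a} {b} {d} eq = begin
    a                    ≈⟨ unit a ⟨
    i * (X * a)          ≈⟨ *-congˡ eq ⟩
    i * (X * b + d)      ≈⟨ distribˡ i (X * b) d ⟩
    i * (X * b) + i * d  ≈⟨ +-congʳ (unit b) ⟩
    b + i * d            ∎
    where
    unit : ∀ a → i * (X * a) ≈ a
    unit a = trans (solve 3 (λ i X a → i :* (X :* a) := (X :* i) :* a) refl i X a)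
      (trans (*-congʳ Xi≈1) (*-identityˡ a))

  module Glue (G : OutmostGraph) (proper : Proper G) {t₂ t₁ t₀ : Carrier}
              (together≈ : S G together ≈ t₂) (apart≈ : ∀ c → S G (apart c) ≈ t₁)
              (allApart≈ : S G allApart ≈ t₀) where
    open Gluing G using (glued)

    private
      s : Pattern → Carrier
      s together  = t₂
      s (apart _) = t₁
      s allApart  = t₀

      S≈s : ∀ q → S G q ≈ s q
      S≈s together  = together≈
      S≈s (apart c) = apart≈ c
      S≈s allApart  = allApart≈

    -- The solver collects the 125 terms. Multiplied by X, the recurrence makes sense in every
    -- commutative ring.
    together-glued : X * S glued together ≈
      X * (Y * t₂ ^ 3) + (6 · t₂ ^ 2 * t₁ + 3 · t₂ * t₁ ^ 2)
    together-glued = trans (S-glued G proper s S≈s together)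
      (solve 5 (λ X Y t₂ t₁ t₀ → :glued X Y t₂ t₁ t₀ together :=
        X :* (Y :* t₂ :^ 3) :+ (6 :· t₂ :^ 2 :* t₁ :+ 3 :· t₂ :* t₁ :^ 2))
      refl X Y t₂ t₁ t₀)

    -- The right side is the same for all three corners, which is what carries the equality of the
    -- three sums from one graph to the next.
    apart-glued : ∀ c → X * S glued (apart c) ≈
      X * (Y * t₂ ^ 2 * t₁) + (t₂ ^ 2 * t₀ + 7 · t₂ * t₁ ^ 2 + 2 · t₂ * t₁ * t₀
                               + 4 · t₁ ^ 3 + t₁ ^ 2 * t₀)
    apart-glued topᶜ = trans (S-glued G proper s S≈s (apart topᶜ))
      (solve 5 (λ X Y t₂ t₁ t₀ → :glued X Y t₂ t₁ t₀ (apart topᶜ) := :apart-glued X Y t₂ t₁ t₀)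
      refl X Y t₂ t₁ t₀)
    apart-glued leftᶜ = trans (S-glued G proper s S≈s (apart leftᶜ))
      (solve 5 (λ X Y t₂ t₁ t₀ → :glued X Y t₂ t₁ t₀ (apart leftᶜ) := :apart-glued X Y t₂ t₁ t₀)
      refl X Y t₂ t₁ t₀)
    apart-glued rightᶜ = trans (S-glued G proper s S≈s (apart rightᶜ))
      (solve 5 (λ X Y t₂ t₁ t₀ → :glued X Y t₂ t₁ t₀ (apart rightᶜ) := :apart-glued X Y t₂ t₁ t₀)
      refl X Y t₂ t₁ t₀)

    allApart-glued : X * S glued allApart ≈
      X * (Y * (3 · t₂ * t₁ ^ 2 + t₁ ^ 3))
      + (12 · t₂ * t₁ * t₀ + 3 · t₂ * t₀ ^ 2 + 14 · t₁ ^ 3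
         + 24 · t₁ ^ 2 * t₀ + 9 · t₁ * t₀ ^ 2 + t₀ ^ 3)
    allApart-glued = trans (S-glued G proper s S≈s allApart)
      (solve 5 (λ X Y t₂ t₁ t₀ → :glued X Y t₂ t₁ t₀ allApart :=
        X :* (Y :* (3 :· t₂ :* t₁ :^ 2 :+ t₁ :^ 3))
        :+ (12 :· t₂ :* t₁ :* t₀ :+ 3 :· t₂ :* t₀ :^ 2 :+ 14 :· t₁ :^ 3
            :+ 24 :· t₁ :^ 2 :* t₀ :+ 9 :· t₁ :* t₀ :^ 2 :+ t₀ :^ 3))
      refl X Y t₂ t₁ t₀)

    module _ {i : Carrier} (Xi≈1 : X * i ≈ 1#) {t₂′ t₁′ t₀′ : Carrier}
             (together≈′ : S glued together ≈ t₂′) (apart≈′ : S glued (apart topᶜ) ≈ t₁′)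
             (allApart≈′ : S glued allApart ≈ t₀′) where

      -- The operations enter through equations, so a caller passes `≡.refl` and keeps its own names
      -- in the conclusion.
      recurrence : ∀ {_⊕_ _⊛_ _⊖_ : Carrier → Carrier → Carrier} {_^′_ _·′_ 1′} →
                   _+_ ≡ _⊕_ → _*_ ≡ _⊛_ → _-_ ≡ _⊖_ → _^_ ≡ _^′_ → _·_ ≡ _·′_ → 1# ≡ 1′ →
                   Recurrence _≈_ _⊕_ _⊛_ _⊖_ _^′_ _·′_ 1′ y i t₂ t₁ t₀ t₂′ t₁′ t₀′
      recurrence ≡.refl ≡.refl ≡.refl ≡.refl ≡.refl ≡.refl = record
        { equations = trans (sym together≈′) (divide Xi≈1 together-glued)
                    , trans (sym apart≈′) (divide Xi≈1 (apart-glued topᶜ))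
                    , trans (sym allApart≈′) (divide Xi≈1 allApart-glued)
        }

    -- Every subgraph has exactly one pattern, so sorting with constant coefficient 1 counts each
    -- weight once.
    total : ∑ (subsets (OutmostGraph.∣E∣ G)) (weight (OutmostGraph.graph G)) ≈ t₂ + 3 · t₁ + t₀
    total = begin
      ∑ as w                                 ≈⟨ ∑-cong as (λ A → *-identityˡ (w A)) ⟨
      ∑ as (λ A → 1# * w A)                  ≈⟨ ∑-linear as (patternOf G) w s S≈s (λ _ → 1#) ⟩
      ∑ patterns (λ p → 1# * s p)
        ≈⟨ solve 3 (λ t₂ t₁ t₀ → :∑ (λ p → con 1 :* :s t₂ t₂ t₂ t₁ t₀ p) := t₂ :+ 3 :· t₁ :+ t₀) refl t₂ t₁ t₀ ⟩
      t₂ + 3 · t₁ + t₀ ∎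
      where
      as = subsets (OutmostGraph.∣E∣ G)
      w = weight (OutmostGraph.graph G)

  private
    :triangle : (X Y : Polynomial 2) → Pattern → Polynomial 2
    :triangle X Y q = List.foldr _:+_ (con 0) (List.map
      (λ A → (if q == patternOf triangle A then con 1 else con 0) :*
             (X :^ (r (OutmostGraph.graph triangle) ⊤ ∸ r (OutmostGraph.graph triangle) A)
              :* Y :^ nullity (OutmostGraph.graph triangle) A))
      (subsets 3))

  -- The only such subgraph is the single edge opposite to `c`.
  apart-triangle : ∀ c → S triangle (apart c) ≈ X
  apart-triangle topᶜ   = solve 2 (λ X Y → :triangle X Y (apart topᶜ)   := X) refl X Y
  apart-triangle leftᶜ  = solve 2 (λ X Y → :triangle X Y (apart leftᶜ)  := X) refl X Y
  apart-triangle rightᶜ = solve 2 (λ X Y → :triangle X Y (apart rightᶜ) := X) refl X Y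

  allApart-triangle : S triangle allApart ≈ X ^ 2
  allApart-triangle = solve 2 (λ X Y → :triangle X Y allApart := X :^ 2) refl X Y

  together-triangle : S triangle together ≈ y + 2 · 1#
  together-triangle = begin
    -- The full triangle contributes Y and the three paths with two edges contribute 1 each.
    S triangle together ≈⟨ solve 2 (λ X Y → :triangle X Y together := Y :+ con 1 :+ 2 :· con 1) refl X Y ⟩
    y - 1# + 1# + 2 · 1# ≈⟨ +-congʳ (trans (+-assoc y (- 1#) 1#) (trans (+-congˡ (-‿inverseˡ 1#)) (+-identityʳ y))) ⟩
    y + 2 · 1# ∎

  module _ (X-cancel : ∀ a b → X * a ≈ X * b → a ≈ b) where

    -- By induction the three sums for one graph are equal, so `apart-glued` applies; it gives the
    -- three new sums a common multiple by X, and X cancels.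
    symmetric-Γ : ∀ n .{{_ : NonZero n}} → ∀ c → S (Γ n) (apart c) ≈ S (Γ n) (apart topᶜ)
    symmetric-Γ (suc zero)      c = trans (apart-triangle c) (sym (apart-triangle topᶜ))
    symmetric-Γ (suc n@(suc _)) c = X-cancel _ _
      (trans (apart-glued c) (sym (apart-glued topᶜ)))
      where open Glue (Γ n) (proper-Γ n) refl (symmetric-Γ n) refl

-- Passing from an integral domain to its fractions

module Embedding {c ℓ} (D : IntegralDomain c ℓ) where
  private
    module R = IntegralDomain D
    module F = Fractions D
  open F using (embed; cross)
  open CommutativeRing F.commutativeRing
  open RawSemiringDefinitions (Semiring.rawSemiring semiring) using (_^_)
  open SemiringSolver R.commutativeSemiring using (solve; con; _:*_; _:+_; _:=_)
  private
    module SR = Sums R.commutativeRing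
  open Sums F.commutativeRing

  embed-+ : ∀ a b → embed (a R.+ b) ≈ embed a + embed b
  embed-+ a b = cross (solve 2 (λ a b → (a :+ b) :* (con 1 :* con 1) :=
    (a :* con 1 :+ b :* con 1) :* con 1) R.refl a b)

  embed-* : ∀ a b → embed (a R.* b) ≈ embed a * embed b
  embed-* a b = cross (solve 2 (λ a b → (a :* b) :* (con 1 :* con 1) := (a :* b) :* con 1) R.refl a b)

  embed-^ : ∀ a {b} n → embed a ≈ b → embed (a R.^ n) ≈ b ^ n
  embed-^ a zero    a≈b = refl
  embed-^ a (suc n) a≈b = trans (embed-* a (a R.^ n)) (*-cong a≈b (embed-^ a n a≈b))

  embed-∑ : ∀ {B : Set} (as : List B) (f : B → R.Carrier) → embed (SR.∑ as f) ≈ ∑ as (embed ∘ f)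
  embed-∑ []       f = refl
  embed-∑ (a ∷ as) f = trans (embed-+ (f a) (SR.∑ as f)) (+-congˡ {embed (f a)} (embed-∑ as f))

  embed-[] : ∀ b → embed SR.[ b ] ≈ [ b ]
  embed-[] true  = refl
  embed-[] false = refl

  module _ (x y : R.Carrier) where
    private
      module WR = Weighted R.commutativeRing x y
      module WK = Weighted F.commutativeRing (embed x) (embed y)

    embed-S : ∀ G q → embed (WR.S G q) ≈ WK.S G q
    embed-S G q = trans (embed-∑ as (λ A → SR.[ q == patternOf G A ] R.* WR.weight graph A))
      (∑-cong as λ A → trans (embed-* SR.[ q == patternOf G A ] (WR.weight graph A))
        (*-cong (embed-[] (q == patternOf G A)) (embed-weight A)))
      where
      open OutmostGraph G
      as = subsets ∣E∣

      embed-weight : ∀ A → embed (WR.weight graph A) ≈ WK.weight graph A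
      embed-weight A = trans (embed-* ((x R.- R.1#) R.^ (r graph ⊤ ∸ r graph A)) ((y R.- R.1#) R.^ nullity graph A))
        -- `embed-+` serves for a difference, as negating a fraction negates its numerator.
        (*-cong (embed-^ (x R.- R.1#) (r graph ⊤ ∸ r graph A) (embed-+ x (R.- R.1#)))
                (embed-^ (y R.- R.1#) (nullity graph A) (embed-+ y (R.- R.1#))))

-- The sums by pattern over ℤ[x,y] and ℚ(x,y)

private
  module Z = Recursion ℤ[x,y].commutativeRing ℤ[x,y].x ℤ[x,y].y
  module ZW = Weighted ℤ[x,y].commutativeRing ℤ[x,y].x ℤ[x,y].y
  module Q = Recursion (Fractions.commutativeRing ℤ[x][y].integralDomain) ℚ⟨x,y⟩.x ℚ⟨x,y⟩.y
  module QW = Weighted (Fractions.commutativeRing ℤ[x][y].integralDomain) ℚ⟨x,y⟩.x ℚ⟨x,y⟩.y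

-- Here and in the next two lemmas the right side is the Boolean to which the decision procedure for
-- the corresponding predicate reduces.
together-classify : ∀ x y z → (together == classify x y z) ≡ x ∧ z
together-classify true  _     true  = ≡.refl
together-classify true  _     false = ≡.refl
together-classify false _     true  = ≡.refl
together-classify false true  false = ≡.refl
together-classify false false false = ≡.refl

apart-classify : ∀ x y z → (apart topᶜ == classify x y z) ≡ z ∧ not x
apart-classify true  _     true  = ≡.refl
apart-classify true  _     false = ≡.refl
apart-classify false _     true  = ≡.refl
apart-classify false true  false = ≡.refl
apart-classify false false false = ≡.refl

allApart-classify : ∀ x y z → (allApart == classify x y z) ≡ not x ∧ (not y ∧ not z)
allApart-classify true  _     true  = ≡.refl
allApart-classify true  _     false = ≡.refl
allApart-classify false true  true  = ≡.refl
allApart-classify false false true  = ≡.refl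
allApart-classify false true  false = ≡.refl
allApart-classify false false false = ≡.refl

S≈T₂ : ∀ n .{{_ : NonZero n}} → ZW.S (Γ n) together ℤ[x,y].≈ T₂ n
S≈T₂ n = ZW.S≈∑-filter (Γ n) together (allTogether? (Γ n))
  λ A → together-classify (linked edges A top left) (linked edges A top right) (linked edges A left right)
  where open OutmostGraph (Γ n)

S≈T₁ : ∀ n .{{_ : NonZero n}} → ZW.S (Γ n) (apart topᶜ) ℤ[x,y].≈ T₁ n
S≈T₁ n = ZW.S≈∑-filter (Γ n) (apart topᶜ) (topApart? (Γ n))
  λ A → apart-classify (linked edges A top left) (linked edges A top right) (linked edges A left right)
  where open OutmostGraph (Γ n)

S≈T₀ : ∀ n .{{_ : NonZero n}} → ZW.S (Γ n) allApart ℤ[x,y].≈ T₀ n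
S≈T₀ n = ZW.S≈∑-filter (Γ n) allApart (allApart? (Γ n))
  λ A → allApart-classify (linked edges A top left) (linked edges A top right) (linked edges A left right)
  where open OutmostGraph (Γ n)

x-1-cancel : let open ℤ[x,y] in ∀ a b → (x - 1#) * a ≈ (x - 1#) * b → a ≈ b
x-1-cancel a b eq = *-cancelʳ x-1≉0 (trans (*-comm a X) (trans eq (*-comm X b)))
  where
  open ℤ[x,y]
  X : Carrier
  X = x - 1#
  x-1≉0 : X ≉ 0#
  -- Equality with zero would force the coefficient 1 of x to vanish in ℤ.
  x-1≉0 e with e .ℤ[x][y].at 0 .ℤ[x].at 1
  ... | ()

symmetric : ∀ n .{{_ : NonZero n}} c → ZW.S (Γ n) (apart c) ℤ[x,y].≈ T₁ n
symmetric n c = ℤ[x,y].trans (Z.symmetric-Γ x-1-cancel n c) (S≈T₁ n)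

embed-≈ : ∀ n .{{_ : NonZero n}} q {t} →
          ZW.S (Γ n) q ℤ[x,y].≈ t → QW.S (Γ n) q ℚ⟨x,y⟩.≈ ℚ⟨x,y⟩.embed t
embed-≈ n q eq = ℚ⟨x,y⟩.trans (ℚ⟨x,y⟩.sym (embed-S ℤ[x,y].x ℤ[x,y].y (Γ n) q)) (ℚ⟨x,y⟩.embed-cong eq)
  where open Embedding ℤ[x][y].integralDomain using (embed-S)

recurrenceΓ : ∀ n .{{_ : NonZero n}} → let open ℚ⟨x,y⟩ in
  Recurrence _≈_ _+_ _*_ _-_ _^_ _·_ 1# y 1/[x-1]
    (embed (T₂ n)) (embed (T₁ n)) (embed (T₀ n))
    (embed (T₂ (suc n))) (embed (T₁ (suc n))) (embed (T₀ (suc n)))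
-- `Γ (suc n)` unfolds to the glued graph only once `n` is visibly a successor.
recurrenceΓ n@(suc _) = Q.Glue.recurrence (Γ n) (proper-Γ n)
  {embed (T₂ n)} {embed (T₁ n)} {embed (T₀ n)}
  (embed-≈ n together (S≈T₂ n)) (λ c → embed-≈ n (apart c) (symmetric n c))
  (embed-≈ n allApart (S≈T₀ n))
  {1/[x-1]} (inverse-inverseʳ (x - 1#) x-1≉0)
  {embed (T₂ (suc n))} {embed (T₁ (suc n))} {embed (T₀ (suc n))}
  (embed-≈ (suc n) together (S≈T₂ (suc n))) (embed-≈ (suc n) (apart topᶜ) (S≈T₁ (suc n)))
  (embed-≈ (suc n) allApart (S≈T₀ (suc n)))
  {_+_} {_*_} {_-_} {_^_} {_·_} {1#}
  ≡.refl ≡.refl ≡.refl ≡.refl ≡.refl ≡.refl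
  where open ℚ⟨x,y⟩

theorem3p1 :
  ((n : ℕ) → .{{_ : NonZero n}} →
    let open ℤ[x,y] in
    T n ≈ T₂ n + 3 · T₁ n + T₀ n)
  ×
  (let open ℤ[x,y] in
    (T₂ 1 ≈ y + 2 · 1#) × (T₁ 1 ≈ x - 1#) × (T₀ 1 ≈ (x - 1#) ^ 2))
  ×
  ((n : ℕ) → .{{_ : NonZero n}} →
    let open ℚ⟨x,y⟩
        t₂ = embed (T₂ n)
        t₁ = embed (T₁ n)
        t₀ = embed (T₀ n)
    in
    (embed (T₂ (suc n)) ≈
      (y - 1#) * t₂ ^ 3
      + 1/[x-1] * (6 · t₂ ^ 2 * t₁ + 3 · t₂ * t₁ ^ 2))
    ×
    (embed (T₁ (suc n)) ≈
      (y - 1#) * t₂ ^ 2 * t₁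
      + 1/[x-1] * (t₂ ^ 2 * t₀ + 7 · t₂ * t₁ ^ 2 + 2 · t₂ * t₁ * t₀
                   + 4 · t₁ ^ 3 + t₁ ^ 2 * t₀))
    ×
    (embed (T₀ (suc n)) ≈
      (y - 1#) * (3 · t₂ * t₁ ^ 2 + t₁ ^ 3)
      + 1/[x-1] * (12 · t₂ * t₁ * t₀ + 3 · t₂ * t₀ ^ 2 + 14 · t₁ ^ 3
                   + 24 · t₁ ^ 2 * t₀ + 9 · t₁ * t₀ ^ 2 + t₀ ^ 3)))
theorem3p1 =
    (λ n → Z.Glue.total (Γ n) (proper-Γ n) (S≈T₂ n) (symmetric n) (S≈T₀ n))
  , ( ℤ[x,y].trans (ℤ[x,y].sym (S≈T₂ 1)) Z.together-triangle
    , ℤ[x,y].trans (ℤ[x,y].sym (S≈T₁ 1)) (Z.apart-triangle topᶜ)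
    , ℤ[x,y].trans (ℤ[x,y].sym (S≈T₀ 1)) Z.allApart-triangle)
  , λ n → Recurrence.equations (recurrenceΓ n)
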